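{- Let $k\ge 1$ be an integer. Given a regular code $X\subseteq A^*$, each of the following properties holds: (i) The three following conditions are equivalent: - $X$ is maximal in the family of $\underline{\mathcal{F}_k}$-independent codes; - $X$ is complete; - $\mu(X)=1$. (ii) One can decide whether $X$ is maximal in the family of $\underline{\mathcal{F}_k}$-independent codes. (iii) If $X$ is $\underline{\mathcal{F}_k}$-independent, it can be embedded into a maximal $\underline{\mathcal{F}_k}$-independent code.
   Context: $A$ is a finite alphabet with $|A|\ge 2$; $A^*$ is the free monoid over $A$ and $|w|$ is the length of $w$. A subset of $A^*$ is regular if it is recognized by a finite automaton; in decidability statements a regular set is given by a finite automaton. A set $X\subseteq A^*$ is a code if for all words $x_1,\dots,x_n,y_1,\dots,y_p\in X$, $x_1\cdots x_n=y_1\cdots y_p$ implies $n=p$ and $x_i=y_i$ for every $i$. $X$ is complete if every word of $A^*$ is a factor (contiguous subword) of some word in $X^*$, the submonoid generated by $X$. $\mu(X)=\sum_{w\in X}|A|^{ -|w|}$ is the uniform Bernoulli measure. $(w,w')\in\mathcal{F}_k$ iff $|w|+|w'|-2|f|\le k$, where $f$ is a maximum length common factor of $w$ and $w'$; $\underline{\mathcal{F}_k}=\mathcal{F}_k\setminus\{(w,w):w\in A^*\}$. For a relation $\tau\subseteq A^*\times A^*$, $\tau(X)=\{y:\exists x\in X,\ (x,y)\in\tau\}$, and $X$ is $\tau$-independent if $\tau(X)\cap X=\emptyset$. A code $X$ is maximal in the family of $\tau$-independent codes (a maximal $\tau$-independent code) if it belongs to that family and $X\subseteq Y$, with $Y$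 in the family, implies $Y=X$.
   Formalization: In (i), the equivalence of maximality with completeness is stated for independent X only; as printed it fails for X={a,ba,bb}, which is complete with μ(X)=1 but not independent. Complete ⇔ μ(X)=1 is stated for every regular code. -}

module Defs where

open import Level using (0ℓ) renaming (suc to lsuc)
open import Data.Fin.Base using (Fin)
open import Data.Fin.Subset using (Subset) renaming (_∈_ to _∈ˢ_)
open import Data.Integer.Base using (+_)
open import Data.List.Base using (List; []; _∷_; _++_; length; concat; map; foldr)
open import Data.List.Relation.Binary.Infix.Heterogeneous using (Infix)
open import Data.List.Relation.Unary.All using (All)
open import Data.List.Relation.Unary.Unique.Propositional using (Unique)
open import Data.Nat.Base as ℕ using (ℕ; NonTrivial; nonTrivial⇒nonZero)
open import Data.Nat.Properties using (m^n≢0)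
open import Data.Product.Base using (_×_; ∃; ∃-syntax)
open import Data.Rational.Base as ℚ using (ℚ; 0ℚ)
open import Relation.Binary.Core using (Rel)
open import Relation.Binary.PropositionalEquality.Core using (_≡_; _≢_)
open import Relation.Unary using (Pred; _∈_; _⊆_; _≐_; _∩_; Empty)

Language : Set → Set₁
Language A = Pred (List A) 0ℓ

------------------------------------------------------------------------
-- Regular sets

record Automaton (A : Set) : Set where
  field
    states     : ℕ
    initial    : Subset states
    final      : Subset states
    transition : Fin states → A → Subset states

  AcceptsFrom : Fin states → Language A
  AcceptsFrom p []      = p ∈ˢ final
  AcceptsFrom p (a ∷ w) = ∃[ r ] (r ∈ˢ transition p a × AcceptsFrom r w)

  Recognized : Language A
  Recognized w = ∃[ p ] (p ∈ˢ initial × AcceptsFrom p w)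

Regular : {A : Set} → Language A → Set
Regular X = ∃ λ M → X ≐ Automaton.Recognized M

------------------------------------------------------------------------
-- Codes and completeness

-- Equality of the two factorizations as lists says both that n = p and that
-- xᵢ = yᵢ for every i.
Code : {A : Set} → Language A → Set
Code X = ∀ xs ys → All X xs → All X ys → concat xs ≡ concat ys → xs ≡ ys

_* : {A : Set} → Language A → Language A
(X *) w = ∃[ xs ] (All X xs × concat xs ≡ w)

-- f is a factor (contiguous subword) of w.
Factor : {A : Set} → Rel (List A) 0ℓ
Factor f w = Infix _≡_ f w

Complete : {A : Set} → Language A → Set
Complete X = ∀ w → ∃[ z ] (z ∈ (X *) × Factor w z)

------------------------------------------------------------------------
-- The uniform Bernoulli measure, over an alphabet with q letters

weight : {A : Set} (q : ℕ) .{{_ : NonTrivial q}} → List A → ℚ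
weight q w = ℚ._/_ (+ 1) (q ℕ.^ length w)
  {{m^n≢0 q (length w) {{nonTrivial⇒nonZero q}}}}

finiteMeasure : {A : Set} (q : ℕ) .{{_ : NonTrivial q}} → List (List A) → ℚ
finiteMeasure q ws = foldr ℚ._+_ 0ℚ (map (weight q) ws)

-- HasMeasure q X r says μ(X) = r. The series defining μ(X) has nonnegative
-- terms, so its sum is the supremum of the sums over finite subsets of X;
-- these subsets are given by lists of pairwise distinct words.
HasMeasure : {A : Set} (q : ℕ) .{{_ : NonTrivial q}} → Language A → ℚ → Set
HasMeasure q X r =
  (∀ ws → Unique ws → All X ws → finiteMeasure q ws ℚ.≤ r)
  × (∀ ε → 0ℚ ℚ.< ε →
       ∃[ ws ] (Unique ws × All X ws × r ℚ.- ε ℚ.< finiteMeasure q ws))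

------------------------------------------------------------------------
-- The factor relations

IsMaxCommonFactor : {A : Set} → List A → List A → List A → Set
IsMaxCommonFactor f w w′ =
  Factor f w × Factor f w′ ×
  (∀ g → Factor g w → Factor g w′ → length g ℕ.≤ length f)

-- The truncated subtraction is exact, since f is a factor of both words.
𝓕 : {A : Set} → ℕ → Rel (List A) 0ℓ
𝓕 k w w′ = ∃[ f ] (IsMaxCommonFactor f w w′ ×
  (length w ℕ.+ length w′) ℕ.∸ 2 ℕ.* length f ℕ.≤ k)

-- 𝓕 k without the diagonal, i.e. the underlined relation.
𝓕≢ : {A : Set} → ℕ → Rel (List A) 0ℓ
𝓕≢ k w w′ = 𝓕 k w w′ × w ≢ w′

------------------------------------------------------------------------
-- Independence and maximality

image : {A : Set} → Rel (List A) 0ℓ → Language A → Language A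
image τ X y = ∃[ x ] (x ∈ X × τ x y)

Independent : {A : Set} → Rel (List A) 0ℓ → Language A → Set
Independent τ X = Empty (image τ X ∩ X)

IndependentCode : {A : Set} → Rel (List A) 0ℓ → Pred (Language A) 0ℓ
IndependentCode τ X = Code X × Independent τ X

MaximalIn : {A : Set} → Pred (Language A) 0ℓ → Pred (Language A) (lsuc 0ℓ)
MaximalIn 𝓒 X = 𝓒 X × (∀ Y → 𝓒 Y → X ⊆ Y → Y ≐ X)

{-# OPTIONS --safe #-}
-- Everything rests on the languages X, X* and the factors of X* having right
-- congruences of finite index: a nonempty such language has a short word, so
-- completeness and independence are decidable, and if X is complete then every
-- word w lies in l⁻¹ X* r⁻¹ with l and r of bounded length. Counting words up to
-- length n in this way shows that the partial sums of μ(X) come within O(1/n)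
-- of 1, while Kraft's inequality bounds the measure of every code by 1; hence a
-- code of measure 1 has no larger code above it.
-- If w is not a factor of X*, take y = aᵏ b w a bⁿ with n = k + |w| + 2. It is
-- unbordered, so the Ehrenfeucht–Rozenberg set Y = X ∪ y(Uy)* is a code, and it is
-- maximal because y z y ∈ Y* for every z. A common factor missing at most k
-- letters of two words of y(Uy)* contains the first b of the leading y and the last
-- a of the trailing y, so the words are aligned at both ends, hence equal; and it
-- contains w, so it is not a factor of a word of X.
module Submission where

open import Defs
open import Data.Bool.Base using (Bool; true; false)
open import Data.Fin.Base using (Fin; toℕ; fromℕ<)
import Data.Fin.Properties as Fin
open import Data.Fin.Subset using () renaming (_∈_ to _∈ˢ_)
open import Data.Fin.Subset.Properties using () renaming (_∈?_ to _∈ˢ?_)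
open import Data.List.Base
  using (List; []; _∷_; _++_; length; map; take; drop; concat; concatMap; filter; foldr; replicate; reverse;
         allFin; cartesianProductWith; cartesianProduct)
open import Data.List.Membership.DecPropositional using () renaming (_∈?_ to mem?)
open import Data.List.Membership.Propositional using (lose) renaming (_∈_ to _∈ˡ_)
open import Data.List.Membership.Propositional.Properties
import Data.List.Membership.Setoid.Properties as Membershipₛ
open import Data.List.Properties
open import Data.List.Relation.Binary.Infix.Heterogeneous as Infix using (MkView)
import Data.List.Relation.Binary.Infix.Heterogeneous.Properties as Infixₚ
open import Data.List.Relation.Binary.Pointwise using (Pointwise-≡⇒≡; ≡⇒Pointwise-≡)
open import Data.List.Relation.Unary.All as All using (All; []; _∷_)
import Data.List.Relation.Unary.All.Properties as Allₚ
open import Data.List.Relation.Unary.AllPairs using ([]; _∷_)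
open import Data.List.Relation.Unary.Any using (Any; here; there; any?; index; satisfied)
open import Data.List.Relation.Unary.Unique.Propositional using (Unique)
import Data.List.Relation.Unary.Unique.Propositional.Properties as Uniqueₚ
open import Data.Maybe.Base using (Maybe; nothing; just)
open import Data.Nat.Base as ℕ using (ℕ; zero; suc; z≤n; s≤s; NonTrivial; nonTrivial⇒nonZero; nonTrivial⇒n>1)
import Data.Nat.Properties as ℕ
open import Data.Product.Base using (_×_; _,_; ∃; ∃-syntax; ∃₂; proj₁; proj₂)
open import Data.Sum.Base using (_⊎_; inj₁; inj₂)
open import Data.Unit.Base using (⊤; tt)
open import Function.Base using (_∘_; id; case_of_)
open import Function.Bundles using (_↔_; _⇔_; mk⇔; Inverse)
open import Relation.Binary.Definitions using (DecidableEquality)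
open import Relation.Binary.PropositionalEquality
open import Relation.Nullary using (¬_; yes; no; does; contradiction)
open import Relation.Nullary.Decidable using (map′; _×-dec_; ¬?; decidable-stable)
open import Relation.Nullary.Decidable.Core using (Dec)
open import Relation.Unary using (Decidable; _∩_; _⊆_; ∁; _≐_)

-- The equivalence of maximality with completeness is stated for independent `X`: when k ≥ 2, the
-- alphabet itself is a complete code of measure 1, yet any two letters are related by `𝓕 k`. Both
-- implications that end in completeness use the same Y. If w is missing from the factors of X*,
-- then y, which contains w, belongs to Y but not to X; so X cannot be maximal, and by Kraft's
-- inequality for Y it cannot have measure 1. All this is constructive: a missing w has to be found,
-- and membership in X* decided in order to tell the words of U from those of X*. The measure never
-- appears as a limit: only finite sums are compared. For Y to be a maximal code, any unbordered y
-- containing w would do. The block aᵏ b in front is there for independence: at most k letters are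
-- lost on the left, so the first b survives and its distance to the start of the word fixes the
-- offset. On the right the last a followed by bⁿ, with n > k, plays this part with the letters
-- exchanged.

private variable
  A B : Set

-- Languages with finitely many right classes.

module FiniteIndexLanguages where
  open import Data.Nat.Base using (_+_; _*_; _∸_; _≤_; _<_)
  open import Data.Nat.Properties hiding (_≟_)

  levi : ∀ (xs : List A) {ys us vs} → xs ++ ys ≡ us ++ vs → length xs ≤ length us →
         ∃[ z ] (us ≡ xs ++ z × ys ≡ z ++ vs)
  levi []       {us = us} eq _ = us , refl , eq
  levi (x ∷ xs) {us = u ∷ us} eq (s≤s le)
    with refl , eq′ ← ∷-injective eq
    with z , p , r ← levi xs eq′ le = z , cong (x ∷_) p , r

  factor⁺ : ∀ (l : List A) {w r} → Factor w (l ++ w ++ r)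
  factor⁺ l {w} {r} = Infix.fromView (MkView l (≡⇒Pointwise-≡ refl) r)

  factor⁻ : ∀ {w z : List A} → Factor w z → ∃₂ λ l r → z ≡ l ++ w ++ r
  factor⁻ p with Infix.toView p
  ... | MkView l eq r with refl ← Pointwise-≡⇒≡ eq = l , r , refl

  -- The letters `bs` are arbitrary because the same enumeration serves for short words over the
  -- alphabet, for Boolean tables and for lists of classes.
  words : List B → ℕ → List (List B)
  words bs zero    = [] ∷ []
  words bs (suc n) = [] ∷ cartesianProductWith _∷_ bs (words bs n)

  words⁺ : ∀ {bs : List B} {n} (w : List B) → (∀ b → b ∈ˡ bs) → length w ≤ n → w ∈ˡ words bs n
  words⁺ {n = zero}  []      all le = here refl
  words⁺ {n = suc n} []      all le = here refl
  words⁺ {n = suc n} (b ∷ w) all (s≤s le) = there (∈-cartesianProductWith⁺ _∷_ (all b) (words⁺ w all le))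

  words-length : ∀ {bs : List B} n {w} → w ∈ˡ words bs n → length w ≤ n
  words-length zero (here refl) = z≤n
  words-length (suc n) (here refl) = z≤n
  words-length {bs = bs} (suc n) (there m)
    with _ , _ , _ , w∈ , refl ← ∈-cartesianProductWith⁻ _∷_ bs (words bs n) m = s≤s (words-length n w∈)

  ∃-split? : {P : List A → List A → Set} → (∀ x v → Dec (P x v)) →
             ∀ u → Dec (∃₂ λ x v → u ≡ x ++ v × P x v)
  ∃-split? P? [] with P? [] []
  ... | yes p = yes ([] , [] , refl , p)
  ... | no ¬p = no λ { ([] , [] , _ , p) → ¬p p }
  ∃-split? P? (a ∷ u) with P? [] (a ∷ u) | ∃-split? (λ x v → P? (a ∷ x) v) u
  ... | yes p | _ = yes ([] , a ∷ u , refl , p)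
  ... | no ¬p | yes (x , v , eq , p) = yes (a ∷ x , v , cong (a ∷_) eq , p)
  ... | no ¬p | no ¬q = no λ where
    ([] , _ , refl , p) → ¬p p
    (_ ∷ x , v , refl , p) → ¬q (x , v , refl , p)

  -- A language with a finite right congruence saturating it, as in the
  -- Myhill–Nerode theorem.
  record FiniteIndex (L : Language A) : Set₁ where
    field
      Class     : Set
      classes   : List Class
      class     : List A → Class
      class∈    : ∀ u → class u ∈ˡ classes
      congruent : ∀ {u v} → class u ≡ class v → ∀ w → L (u ++ w) → L (v ++ w)

    index# : ℕ
    index# = length classes

    -- Pumping: two of the prefixes of `w` share a class, and the stretch between them is cut out.
    -- Positions in `classes` are compared instead of the classes themselves, for which no decidable
    -- equality is assumed.
    shrink : ∀ w → L w → index# ≤ length w → ∃[ v ] (L v × length v < length w)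
    shrink w Lw le
      with i , j , i<j , eq ← Fin.pigeonhole (s≤s le)
          (λ (i : Fin (suc (length w))) → index (class∈ (take (toℕ i) w)))
      = take (toℕ i) w ++ drop (toℕ j) w
      , congruent (sym (Membershipₛ.index-injective (setoid Class) (class∈ _) (class∈ _) eq)) _
          (subst L (sym (take++drop≡id (toℕ j) w)) Lw)
      , (begin-strict
          length (take (toℕ i) w ++ drop (toℕ j) w) ≡⟨ length-++ (take (toℕ i) w) ⟩
          length (take (toℕ i) w) + length (drop (toℕ j) w)
            ≡⟨ cong₂ _+_ (length-take (toℕ i) w) (length-drop (toℕ j) w) ⟩
          _ ≤⟨ +-monoˡ-≤ _ (m⊓n≤m (toℕ i) _) ⟩
          _ <⟨ +-monoˡ-< _ i<j ⟩
          _ ≡⟨ m+[n∸m]≡n (Fin.toℕ≤pred[n] j) ⟩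
          length w ∎)
      where open ≤-Reasoning

    short : ∀ w → L w → ∃[ v ] (L v × length v ≤ index#)
    short w Lw = go (length w) w ≤-refl Lw
      where
      go : ∀ n w → length w ≤ n → L w → ∃[ v ] (L v × length v ≤ index#)
      go n w le Lw with ≤-total (length w) index#
      ... | inj₁ p = w , Lw , p
      go zero w le Lw | inj₂ p = w , Lw , ≤-trans le z≤n
      go (suc n) w le Lw | inj₂ p with v , Lv , v<w ← shrink w Lw p = go n v (≤-pred (≤-trans v<w le)) Lv

  ∃-word? : {L : Language A} (as : List A) → (∀ a → a ∈ˡ as) → FiniteIndex L → Decidable L → Dec (∃ L)
  ∃-word? {L = L} as all fi L? = map′ satisfied to (any? L? (words as index#))
    where
    open FiniteIndex fi
    to : ∃ L → Any L (words as index#)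
    to (w , Lw) with v , Lv , le ← short w Lw = lose (words⁺ v all le) Lv

  fi-∩ : {L M : Language A} → FiniteIndex L → FiniteIndex M → FiniteIndex (L ∩ M)
  fi-∩ K L = record
    { class     = λ u → K.class u , L.class u
    ; classes   = cartesianProduct K.classes L.classes
    ; class∈    = λ u → ∈-cartesianProduct⁺ (K.class∈ u) (L.class∈ u)
    ; congruent = λ eq w (Kw , Lw) → K.congruent (cong proj₁ eq) w Kw , L.congruent (cong proj₂ eq) w Lw
    }
    where
    module K = FiniteIndex K
    module L = FiniteIndex L

  fi-∁ : {L : Language A} → FiniteIndex L → FiniteIndex (∁ L)
  fi-∁ L = record
    { classes = L.classes ; class = L.class ; class∈ = L.class∈
    ; congruent = λ eq w ¬Lw Lw → ¬Lw (L.congruent (sym eq) w Lw)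
    }
    where module L = FiniteIndex L

  fi-prepend : {L : Language A} (s : List A) → FiniteIndex L → FiniteIndex (λ w → L (s ++ w))
  fi-prepend {L = L} s F = record
    { classes = F.classes ; class = λ u → F.class (s ++ u) ; class∈ = λ u → F.class∈ (s ++ u)
    ; congruent = λ {u} {v} eq w Lw →
        subst L (++-assoc s v w) (F.congruent eq w (subst L (sym (++-assoc s u w)) Lw))
    }
    where module F = FiniteIndex F

  fi-append : {L : Language A} (t : List A) → FiniteIndex L → FiniteIndex (λ w → L (w ++ t))
  fi-append {L = L} t F = record
    { classes = F.classes ; class = F.class ; class∈ = F.class∈
    ; congruent = λ {u} {v} eq w Lw →
        subst L (sym (++-assoc v w t)) (F.congruent eq (w ++ t) (subst L (++-assoc u w t) Lw))
    }
    where module F = FiniteIndex F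

  -- R u b reads "state b is reachable by u", G b w reads "w is accepted from b";
  -- the class of u is the truth table of R u.
  fi-relation : {L : Language A} (bs : List B) (R : List A → B → Set) (R? : ∀ u b → Dec (R u b))
                (G : B → List A → Set) →
                (∀ u w → L (u ++ w) → ∃[ b ] (b ∈ˡ bs × R u b × G b w)) →
                (∀ u w b → R u b → G b w → L (u ++ w)) →
                FiniteIndex L
  fi-relation {B = B} {L = L} bs R R? G split join = record
    { classes = words (true ∷ false ∷ []) (length bs)
    ; class = table
    ; class∈ = λ u → words⁺ (table u) (λ { true → here refl ; false → there (here refl) })
        (≤-reflexive (length-map _ bs))
    ; congruent = λ {u} {v} eq w Lw → let b , b∈ , Rub , Gbw = split u w Lw in
        join v w b (transfer bs eq b∈ Rub) Gbw
    }
    where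
    table : List _ → List Bool
    table u = map (λ b → does (R? u b)) bs

    transfer : ∀ {u v b} cs → map (λ b → does (R? u b)) cs ≡ map (λ b → does (R? v b)) cs → b ∈ˡ cs → R u b →
        R v b
    transfer {u} {v} (c ∷ cs) eq (there b∈) Rub = transfer cs (proj₂ (∷-injective eq)) b∈ Rub
    transfer {u} {v} (c ∷ cs) eq (here refl) Rub with R? u c | R? v c | proj₁ (∷-injective eq)
    ... | _     | yes r | _  = r
    ... | no ¬r | no _  | _  = contradiction Rub ¬r

  -- The submonoid generated by a language.

  module Star {A : Set} {X : Language A} where

    []∈* : (X *) []
    []∈* = [] , [] , refl

    x∈* : ∀ {x} → X x → (X *) x
    x∈* {x} Xx = x ∷ [] , Xx ∷ [] , ++-identityʳ x

    ++∈* : ∀ {u v} → (X *) u → (X *) v → (X *) (u ++ v)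
    ++∈* (xs , Xxs , refl) (ys , Xys , refl) = xs ++ ys , Allₚ.++⁺ Xxs Xys , sym (concat-++ xs ys)

    -- `X` is arbitrary here and may contain the empty word, so empty factors in front are
    -- discarded. The factor taken off is nonempty, which lets recursions on the rest terminate.
    *-uncons : ∀ {c w} → (X *) (c ∷ w) → ∃₂ λ x v → w ≡ x ++ v × X (c ∷ x) × (X *) v
    *-uncons ([] ∷ xs , _ ∷ Xxs , eq) = *-uncons (xs , Xxs , eq)
    *-uncons ((c ∷ x) ∷ xs , Xx ∷ Xxs , refl) = x , concat xs , refl , Xx , xs , Xxs , refl

    -- A boundary between u and w cuts at most one factor.
    Cut : List A → List A → Set
    Cut u w = ((X *) u × (X *) w)
      ⊎ (∃₂ λ x v → u ≡ x ++ v × (X *) x × ∃₂ λ v′ w′ → w ≡ v′ ++ w′ × X (v ++ v′) × (X *) w′)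

    cut : ∀ u {w} xs → All X xs → concat xs ≡ u ++ w → Cut u w
    cut []        xs Xxs eq = inj₁ ([]∈* , xs , Xxs , eq)
    cut u@(_ ∷ _) (x ∷ xs) (Xx ∷ Xxs) eq with ≤-total (length x) (length u)
    ... | inj₂ le with v′ , p , r ← levi u (sym eq) le =
      inj₂ ([] , u , refl , []∈* , v′ , concat xs , r , subst X p Xx , xs , Xxs , refl)
    ... | inj₁ le with z , p , r ← levi x eq le with cut z xs Xxs r
    ...   | inj₁ (sz , sw) = inj₁ (subst (X *) (sym p) (++∈* (x∈* Xx) sz) , sw)
    ...   | inj₂ (x′ , v , q , sx , rest) =
      inj₂ (x ++ x′ , v , trans p (trans (cong (x ++_) q) (sym (++-assoc x x′ v))) , ++∈* (x∈* Xx) sx , rest)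

  -- Runs of an automaton.

  module Paths {A : Set} (M : Automaton A) where
    open Automaton M

    Path : Fin states → List A → Fin states → Set
    Path p []      r = p ≡ r
    Path p (a ∷ w) r = ∃[ s ] (s ∈ˢ transition p a × Path s w r)

    path? : ∀ p w r → Dec (Path p w r)
    path? p []      r = p Fin.≟ r
    path? p (a ∷ w) r = Fin.any? λ s → s ∈ˢ? transition p a ×-dec path? s w r

    accepts? : ∀ p w → Dec (AcceptsFrom p w)
    accepts? p []      = p ∈ˢ? final
    accepts? p (a ∷ w) = Fin.any? λ s → s ∈ˢ? transition p a ×-dec accepts? s w

    recognized? : Decidable Recognized
    recognized? w = Fin.any? λ p → p ∈ˢ? initial ×-dec accepts? p w

    Reach : List A → Fin states → Set
    Reach u p = ∃[ i ] (i ∈ˢ initial × Path i u p)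

    reach? : ∀ u p → Dec (Reach u p)
    reach? u p = Fin.any? λ i → i ∈ˢ? initial ×-dec path? i u p

    accepts-split : ∀ p u {w} → AcceptsFrom p (u ++ w) → ∃[ r ] (Path p u r × AcceptsFrom r w)
    accepts-split p []      acc = p , refl , acc
    accepts-split p (a ∷ u) (s , s∈ , acc) with r , path , acc′ ← accepts-split s u acc =
        r , (s , s∈ , path) , acc′

    accepts-join : ∀ p u {r w} → Path p u r → AcceptsFrom r w → AcceptsFrom p (u ++ w)
    accepts-join p []      refl acc = acc
    accepts-join p (a ∷ u) (s , s∈ , path) acc = s , s∈ , accepts-join s u path acc

    recognized-split : ∀ u {w} → Recognized (u ++ w) → ∃[ r ] (Reach u r × AcceptsFrom r w)
    recognized-split u (i , i∈ , acc) with r , path , acc′ ← accepts-split i u acc =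
        r , (i , i∈ , path) , acc′

    recognized-join : ∀ u {r w} → Reach u r → AcceptsFrom r w → Recognized (u ++ w)
    recognized-join u (i , i∈ , path) acc = i , i∈ , accepts-join i u path acc

  -- Factors of a language and their contexts.

  InFactor : Language A → Language A
  InFactor L w = ∃₂ λ l r → L (l ++ w ++ r)

  -- Only left contexts need recording, as the right one belongs to the continuation. By
  -- `factor-short` those of length at most `index#` suffice, hence finitely many classes.
  fi-factor : {L : Language A} (as : List A) → (∀ a → a ∈ˡ as) → FiniteIndex L → FiniteIndex (InFactor L)
  -- `l` is shortened with `w` and `r` fixed, then `r` with `w` and the new `l` fixed. Both
  -- quotients reuse the classes of `L`, so the bound is the same for every `w`; the lower bound on
  -- the measure depends on this uniformity.
  factor-short : {L : Language A} (F : FiniteIndex L) → ∀ w → InFactor L w →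
    ∃₂ λ l r → L (l ++ w ++ r) × length l ≤ FiniteIndex.index# F × length r ≤ FiniteIndex.index# F
  factor-short {L = L} F w (l , r , p)
    with l′ , p′ , l≤ ← FiniteIndex.short (fi-append (w ++ r) F) l p
    with r′ , p″ , r≤ ← FiniteIndex.short (fi-prepend (l′ ++ w) F) r (subst L (sym (++-assoc l′ w r)) p′)
    = l′ , r′ , subst L (++-assoc l′ w r′) p″ , l≤ , r≤

  fi-factor {L = L} as all F = record
    { classes = words classes (length contexts)
    ; class = λ u → map (λ l → class (l ++ u)) contexts
    ; class∈ = λ u → words-all _ (map-All contexts) (≤-reflexive (length-map _ contexts))
    ; congruent = λ {u} {v} eq w Fuw →
        let l , r , p , l≤ , _ = factor-short F (u ++ w) Fuw
            move : ∀ u → l ++ (u ++ w) ++ r ≡ (l ++ u) ++ (w ++ r)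
            move u = trans (cong (l ++_) (++-assoc u w r)) (sym (++-assoc l u (w ++ r)))
        in l , r , subst L (sym (move v)) (congruent (at contexts eq (words⁺ l all l≤)) (w ++ r) (subst L (move u) p))
    }
    where
    open FiniteIndex F
    contexts = words as index#

    map-All : ∀ {u} ls → All (_∈ˡ classes) (map (λ l → class (l ++ u)) ls)
    map-All []       = []
    map-All (l ∷ ls) = class∈ _ ∷ map-All ls

    words-all : ∀ {n} cs → All (_∈ˡ classes) cs → length cs ≤ n → cs ∈ˡ words classes n
    words-all {n = zero}  []       _ _ = here refl
    words-all {n = suc n} []       _ _ = here refl
    words-all {n = suc n} (c ∷ cs) (c∈ ∷ cs∈) (s≤s le) =
        there (∈-cartesianProductWith⁺ _∷_ c∈ (words-all cs cs∈ le))

    at : ∀ {u v l} ls → map (λ l → class (l ++ u)) ls ≡ map (λ l → class (l ++ v)) ls → l ∈ˡ ls →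
        class (l ++ u) ≡ class (l ++ v)
    at (_ ∷ ls) eq (here refl) = proj₁ (∷-injective eq)
    at (_ ∷ ls) eq (there l∈)  = at ls (proj₂ (∷-injective eq)) l∈

  inFactor? : {L : Language A} (as : List A) → (∀ a → a ∈ˡ as) → FiniteIndex L → Decidable L →
      Decidable (InFactor L)
  inFactor? as all F L? w = map′
    (λ p → let l , q = satisfied p ; r , s = satisfied q in l , r , s)
    (λ p → let l , r , q , l≤ , r≤ = factor-short F w p in lose (words⁺ l all l≤) (lose (words⁺ r all r≤) q))
    (any? (λ l → any? (λ r → L? (l ++ w ++ r)) contexts) contexts)
    where contexts = words as (FiniteIndex.index# F)

  -- Enumerating and deciding X*.

  module Products {X : Language A} (as : List A) (all : ∀ a → a ∈ˡ as) (X? : Decidable X) where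
    open Star

    upTo : ℕ → List (List A)
    upTo T = filter X? (words as T)

    -- The recursion P = 1 + S P of the geometric series, at the level of lists; `μ-products` sums
    -- it. A word with several factorizations is repeated, which is harmless for an upper bound.
    products : ℕ → ℕ → List (List A)
    products T zero    = [] ∷ []
    products T (suc m) = [] ∷ cartesianProductWith _++_ (upTo T) (products T m)

    products-sound : ∀ T m {w} → w ∈ˡ products T m → (X *) w
    products-sound T zero    (here refl) = []∈*
    products-sound T (suc m) (here refl) = []∈*
    products-sound T (suc m) (there w∈) with ∈-cartesianProductWith⁻ _++_ (upTo T) (products T m) w∈
    ... | x , v , x∈ , v∈ , refl =
        ++∈* (x∈* (proj₂ (∈-filter⁻ X? {xs = words as T} x∈))) (products-sound T m v∈)

    -- The factors taken off are nonempty, so the length of `w` bounds their number as well as their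
    -- lengths. `T` stays fixed while `m` decreases.
    products-complete : ∀ T m w → length w ≤ T → length w ≤ m → (X *) w → w ∈ˡ products T m
    products-complete T zero    []      _ _ _ = here refl
    products-complete T (suc m) []      _ _ _ = here refl
    products-complete T (suc m) (c ∷ w) ≤T (s≤s ≤m) p with *-uncons p
    ... | x , v , refl , Xcx , sv = there (∈-cartesianProductWith⁺ _++_
            (∈-filter⁺ X?
                (words⁺ (c ∷ x) all
                (≤-trans (s≤s (m≤m+n _ _)) (subst (λ n → suc n ≤ T) (length-++ x) ≤T))) Xcx)
            (products-complete T m v (≤-trans (n≤1+n _) (≤-trans (s≤s |v|≤) ≤T)) (≤-trans |v|≤ ≤m) sv))
      where
      |v|≤ : length v ≤ length (x ++ v)
      |v|≤ = subst (length v ≤_) (sym (length-++ x)) (m≤n+m _ (length x))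

    star? : DecidableEquality A → Decidable (X *)
    star? _≟_ w = map′ (products-sound _ _) (products-complete _ _ w ≤-refl ≤-refl)
      (mem? (≡-dec _≟_) w (products (length w) (length w)))

  -- Finite index of a regular language and of its star.

  module RegularStar {X : Language A} (M : Automaton A) (X≐ : X ≐ Automaton.Recognized M)
      (star? : Decidable (X *)) where
    open Paths M
    open Automaton M
    open Star

    fi-regular : FiniteIndex X
    fi-regular = fi-relation (allFin states) Reach reach? AcceptsFrom
      (λ u w Xuw → let r , reach , acc = recognized-split u (proj₁ X≐ Xuw) in r , ∈-allFin r , reach , acc)
      (λ u w r reach acc → proj₂ X≐ (recognized-join u reach acc))

    -- States of an automaton for X*: `nothing` is a boundary between two factors, `just p` a factor
    -- in progress that has brought `M` to the state `p`.
    Reach* : List A → Maybe (Fin states) → Set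
    Reach* u nothing  = (X *) u
    Reach* u (just p) = ∃₂ λ x v → u ≡ x ++ v × (X *) x × Reach v p

    Accepts* : Maybe (Fin states) → List A → Set
    Accepts* nothing  w = (X *) w
    Accepts* (just p) w = ∃₂ λ v w′ → w ≡ v ++ w′ × AcceptsFrom p v × (X *) w′

    reach*? : ∀ u p → Dec (Reach* u p)
    reach*? u nothing  = star? u
    reach*? u (just p) = ∃-split? (λ x v → star? x ×-dec reach? v p) u

    fi-star : FiniteIndex (X *)
    fi-star = fi-relation (nothing ∷ map just (allFin states)) Reach* reach*? Accepts* split join
      where
      split : ∀ u w → (X *) (u ++ w) →
          ∃[ p ] (p ∈ˡ nothing ∷ map just (allFin states) × Reach* u p × Accepts* p w)
      split u w (xs , Xxs , eq) with cut u xs Xxs eq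
      ... | inj₁ (su , sw) = nothing , here refl , su , sw
      ... | inj₂ (x , v , eq , sx , v′ , w′ , eq′ , Xvv′ , sw′)
        with r , reach , acc ← recognized-split v (proj₁ X≐ Xvv′) =
          just r , there (∈-map⁺ just (∈-allFin r)) , (x , v , eq , sx , reach) , v′ , w′ , eq′ , acc , sw′

      join : ∀ u w p → Reach* u p → Accepts* p w → (X *) (u ++ w)
      join u w nothing  su sw = ++∈* su sw
      join u w (just p) (x , v , refl , sx , reach) (v′ , w′ , refl , acc , sw′) =
        subst (X *) (trans (cong (x ++_) (++-assoc v v′ w′)) (sym (++-assoc x v (v′ ++ w′))))
          (++∈* sx (++∈* (x∈* (proj₂ X≐ (recognized-join v reach acc))) sw′))

  -- The state after f is the delay b by which s′ f is ahead of s f.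
  fi-equation-≤ : (as : List A) → (∀ a → a ∈ˡ as) → DecidableEquality A →
                  ∀ s t s′ t′ → length s ≤ length s′ → FiniteIndex {A} (λ f → s ++ f ++ t ≡ s′ ++ f ++ t′)
  fi-equation-≤ {A = A} as all _≟_ s t s′ t′ s≤s′ = fi-relation (words as (length s′))
    (λ f b → s′ ++ f ≡ (s ++ f) ++ b) (λ f b → ≡-dec _≟_ _ _)
    (λ b w → w ++ t ≡ b ++ w ++ t′) split join
    where
    assoc₃ : ∀ s f w (t : List A) → s ++ (f ++ w) ++ t ≡ (s ++ f) ++ w ++ t
    assoc₃ s f w t = trans (cong (s ++_) (++-assoc f w t)) (sym (++-assoc s f (w ++ t)))

    split : ∀ f w → s ++ (f ++ w) ++ t ≡ s′ ++ (f ++ w) ++ t′ →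
            ∃[ b ] (b ∈ˡ words as (length s′) × s′ ++ f ≡ (s ++ f) ++ b × w ++ t ≡ b ++ w ++ t′)
    split f w eq with levi (s ++ f) (trans (sym (assoc₃ s f w t)) (trans eq (assoc₃ s′ f w t′)))
                        (subst₂ _≤_ (sym (length-++ s)) (sym (length-++ s′)) (+-monoˡ-≤ (length f) s≤s′))
    ... | b , p , r = b , words⁺ b all |b|≤ , p , r
      where
      open ≤-Reasoning
      |b|≤ : length b ≤ length s′
      |b|≤ = +-cancelˡ-≤ (length f) _ _ (begin
        length f + length b ≤⟨ +-monoˡ-≤ (length b) (m≤n+m (length f) (length s)) ⟩
        length s + length f + length b ≡⟨ cong (_+ length b) (length-++ s) ⟨
        length (s ++ f) + length b ≡⟨ length-++ (s ++ f) ⟨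
        length ((s ++ f) ++ b) ≡⟨ cong length p ⟨
        length (s′ ++ f) ≡⟨ length-++ s′ ⟩
        length s′ + length f ≡⟨ +-comm (length s′) _ ⟩
        length f + length s′ ∎)

    join : ∀ f w b → s′ ++ f ≡ (s ++ f) ++ b → w ++ t ≡ b ++ w ++ t′ →
        s ++ (f ++ w) ++ t ≡ s′ ++ (f ++ w) ++ t′
    join f w b p r = begin
      s ++ (f ++ w) ++ t ≡⟨ assoc₃ s f w t ⟩
      (s ++ f) ++ w ++ t ≡⟨ cong ((s ++ f) ++_) r ⟩
      (s ++ f) ++ b ++ w ++ t′ ≡⟨ ++-assoc (s ++ f) b _ ⟨
      ((s ++ f) ++ b) ++ w ++ t′ ≡⟨ cong (_++ (w ++ t′)) p ⟨
      (s′ ++ f) ++ w ++ t′ ≡⟨ assoc₃ s′ f w t′ ⟨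
      s′ ++ (f ++ w) ++ t′ ∎
      where open ≡-Reasoning

  -- Two words of X in given contexts of a common factor `f` violate independence only if they
  -- differ; the search for such an `f` therefore needs finite index for this equation too.
  fi-equation : (as : List A) → (∀ a → a ∈ˡ as) → DecidableEquality A →
                ∀ s t s′ t′ → FiniteIndex {A} (λ f → s ++ f ++ t ≡ s′ ++ f ++ t′)
  fi-equation as all _≟_ s t s′ t′ with ≤-total (length s) (length s′)
  ... | inj₁ s≤s′ = fi-equation-≤ as all _≟_ s t s′ t′ s≤s′
  ... | inj₂ s′≤s = record
    { classes = classes ; class = class ; class∈ = class∈
    ; congruent = λ eq w p → sym (congruent eq w (sym p)) }
    where open FiniteIndex (fi-equation-≤ as all _≟_ s′ t′ s t s′≤s)

open FiniteIndexLanguages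

-- Inequalities for powers and multiples of rationals.

module RationalPowers where
  open import Data.Integer.Base as ℤ using (-[1+_]) renaming (+_ to int)
  import Data.Integer.Properties as ℤ
  import Data.Nat.Coprimality as Coprimality
  open import Data.Rational.Base
  open import Data.Rational.Properties hiding (_≟_)
  open import Data.Rational.Solver using (module +-*-Solver)
  import Data.Rational.Unnormalised.Base as ℚᵘ
  import Data.Rational.Unnormalised.Properties as ℚᵘ

  fromℚᵘ-homo-* : ∀ p q → fromℚᵘ p * fromℚᵘ q ≡ fromℚᵘ (p ℚᵘ.* q)
  fromℚᵘ-homo-* p q = toℚᵘ-injective (ℚᵘ.≃-trans (toℚᵘ-homo-* (fromℚᵘ p) (fromℚᵘ q))
    (ℚᵘ.≃-trans (ℚᵘ.*-cong (toℚᵘ-fromℚᵘ p) (toℚᵘ-fromℚᵘ q)) (ℚᵘ.≃-sym (toℚᵘ-fromℚᵘ (p ℚᵘ.* q)))))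

  1/-* : ∀ m n .{{_ : ℕ.NonZero m}} .{{_ : ℕ.NonZero n}} .{{_ : ℕ.NonZero (m ℕ.* n)}} →
         (int 1 / m) * (int 1 / n) ≡ int 1 / (m ℕ.* n)
  1/-* (suc m) (suc n) = fromℚᵘ-homo-* (ℚᵘ.mkℚᵘ (int 1) m) (ℚᵘ.mkℚᵘ (int 1) n)

  -- Abstract, lest sums and products of numerals unfold to gcd computations.
  abstract
    ι : ℕ → ℚ
    ι n = mkℚ (int n) 0 (Coprimality.sym (Coprimality.1-coprimeTo n))

    ι-suc : ∀ n → ι (suc n) ≡ 1ℚ + ι n
    ι-suc n = toℚᵘ-injective
        (ℚᵘ.≃-trans (ℚᵘ.*≡* (cong (λ k → (int 1 ℤ.+ k) ℤ.* int 1) (sym (ℤ.*-identityʳ (int n)))))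
      (ℚᵘ.≃-sym (toℚᵘ-homo-+ 1ℚ (ι n))))

    ι-mono : ∀ {m n} → m ℕ.≤ n → ι m ≤ ι n
    ι-mono m≤n = *≤* (ℤ.*-monoʳ-≤-nonNeg (int 1) (ℤ.+≤+ m≤n))

    ι-0 : ι 0 ≡ 0ℚ
    ι-0 = refl

    ι-1 : ι 1 ≡ 1ℚ
    ι-1 = refl

    0≤ι : ∀ n → 0ℚ ≤ ι n
    0≤ι n = ι-mono {0} z≤n

    ι-*-1/ : ∀ n .{{_ : ℕ.NonZero n}} → ι n * (int 1 / n) ≡ 1ℚ
    ι-*-1/ n@(suc n-1) = toℚᵘ-injective (ℚᵘ.≃-trans (toℚᵘ-homo-* (ι n) (int 1 / n))
      (ℚᵘ.≃-trans (ℚᵘ.*-congˡ {ℚᵘ.mkℚᵘ (int n) 0} (toℚᵘ-fromℚᵘ (ℚᵘ.mkℚᵘ (int 1) n-1)))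
          (ℚᵘ.*≡* (trans (ℤ.*-identityʳ _)
          (trans (ℤ.*-identityʳ (int n)) (sym (trans (ℤ.*-identityˡ _) (ℤ.*-identityˡ (int n)))))))))

    ≤ι : ∀ p → ∃[ n ] p ≤ ι n
    ≤ι (mkℚ (int n)    d c) = n , *≤* (ℤ.*-monoˡ-≤-nonNeg (int n) (ℤ.+≤+ (s≤s z≤n)))
    ≤ι (mkℚ -[1+ n ] d c) = 0 , *≤* ℤ.-≤+

  archimedean : ∀ x y → 0ℚ < x → ∃[ n ] y < ι n * x
  archimedean x y 0<x with ≤ι (y * (1/ x) {{≢-nonZero (≢-sym (<⇒≢ 0<x))}})
  -- `n` bounds y / x only weakly; its successor makes the inequality strict.
  ... | n , le = suc n , (begin-strict
      y ≡⟨ *-identityʳ y ⟨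
      y * 1ℚ ≡⟨ cong (y *_) (*-inverseˡ x) ⟨
      y * (1/ x * x) ≡⟨ *-assoc y (1/ x) x ⟨
      y * 1/ x * x ≤⟨ *-monoʳ-≤-nonNeg x {{pos⇒nonNeg x}} le ⟩
      ι n * x <⟨ *-monoˡ-<-pos x ι<ι ⟩
      ι (suc n) * x ∎)
    where
    open ≤-Reasoning
    instance
      _ = ≢-nonZero (≢-sym (<⇒≢ 0<x))
      _ = positive 0<x
    ι<ι : ι n < ι (suc n)
    ι<ι = subst₂ _<_ (+-identityˡ (ι n)) (sym (ι-suc n)) (+-monoˡ-< (ι n) {0ℚ} {1ℚ} (*<* (ℤ.+<+ (s≤s z≤n))))

  *-mono-≤ : ∀ {a b c d} → 0ℚ ≤ a → 0ℚ ≤ d → a ≤ b → c ≤ d → a * c ≤ b * d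
  *-mono-≤ {a} {b} {c} {d} 0≤a 0≤d a≤b c≤d =
    ≤-trans (*-monoˡ-≤-nonNeg a {{nonNegative 0≤a}} c≤d) (*-monoʳ-≤-nonNeg d {{nonNegative 0≤d}} a≤b)

  0≤* : ∀ {a b} → 0ℚ ≤ a → 0ℚ ≤ b → 0ℚ ≤ a * b
  0≤* {a} {b} 0≤a 0≤b = ≤-trans (≤-reflexive (sym (*-zeroʳ a))) (*-monoˡ-≤-nonNeg a {{nonNegative 0≤a}} 0≤b)

  infixr 8 _^_
  _^_ : ℚ → ℕ → ℚ
  p ^ zero  = 1ℚ
  p ^ suc n = p * p ^ n

  0≤1 : 0ℚ ≤ 1ℚ
  0≤1 = *≤* (ℤ.+≤+ z≤n)

  0≤^ : ∀ {p} n → 0ℚ ≤ p → 0ℚ ≤ p ^ n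
  0≤^ zero    0≤p = 0≤1
  0≤^ (suc n) 0≤p = 0≤* 0≤p (0≤^ n 0≤p)

  ^-+ : ∀ p m n → p ^ (m ℕ.+ n) ≡ p ^ m * p ^ n
  ^-+ p zero    n = sym (*-identityˡ _)
  ^-+ p (suc m) n = trans (cong (p *_) (^-+ p m n)) (sym (*-assoc p _ _))

  bernoulli : ∀ {x} n → 0ℚ ≤ x → 1ℚ + ι n * x ≤ (1ℚ + x) ^ n
  bernoulli {x} zero    0≤x =
      ≤-reflexive (trans (cong (λ n → 1ℚ + n * x) ι-0) (trans (cong (1ℚ +_) (*-zeroˡ x)) (+-identityʳ 1ℚ)))
  bernoulli {x} (suc n) 0≤x = begin
      1ℚ + ι (suc n) * x ≡⟨ cong (λ m → 1ℚ + m * x) (ι-suc n) ⟩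
      1ℚ + (1ℚ + ι n) * x ≡⟨ +-identityʳ _ ⟨
      1ℚ + (1ℚ + ι n) * x + 0ℚ ≤⟨ +-monoʳ-≤ (1ℚ + (1ℚ + ι n) * x) (0≤* (0≤ι n) (0≤* 0≤x 0≤x)) ⟩
      1ℚ + (1ℚ + ι n) * x + ι n * (x * x)
        ≡⟨ solve 2 (λ n x →
            con 1ℚ :+ (con 1ℚ :+ n) :* x :+ n :* (x :* x) := (con 1ℚ :+ x) :* (con 1ℚ :+ n :* x)) refl
            (ι n) x ⟩
      (1ℚ + x) * (1ℚ + ι n * x)
        ≤⟨ *-monoˡ-≤-nonNeg (1ℚ + x) {{nonNegative (+-mono-≤ 0≤1 0≤x)}} (bernoulli n 0≤x) ⟩
      (1ℚ + x) * (1ℚ + x) ^ n ∎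
    where
    open ≤-Reasoning
    open +-*-Solver

  -- A sequence of powers with linear growth is bounded: if M = 1 + x with x > 0,
  -- then M^(2n) ≥ (1 + n x)² exceeds 1 + 2 n L as soon as n x² > 2 L.
  linear-powers⇒≤1 : ∀ M L → (∀ n → M ^ n ≤ ι (suc (n ℕ.* L))) → M ≤ 1ℚ
  linear-powers⇒≤1 M L bound with M ≤? 1ℚ
  ... | yes M≤1 = M≤1
  ... | no  M≰1 = contradiction (begin-strict
      ι (suc ((n ℕ.+ n) ℕ.* L)) ≡⟨ ι-suc ((n ℕ.+ n) ℕ.* L) ⟩
      1ℚ + ι ((n ℕ.+ n) ℕ.* L)
        ≡⟨ cong (λ k → 1ℚ + ι k) (trans (ℕ.*-distribʳ-+ L n n) (sym (ℕ.*-distribˡ-+ n L L))) ⟩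
      1ℚ + ι (n ℕ.* (L ℕ.+ L)) ≡⟨ cong (λ y → 1ℚ + y) (ι-* n (L ℕ.+ L)) ⟩
      1ℚ + ι n * ι (L ℕ.+ L) ≤⟨ +-monoʳ-≤ 1ℚ (*-monoˡ-≤-nonNeg (ι n) {{nonNegative (0≤ι n)}} (<⇒≤ 2L<nxx)) ⟩
      1ℚ + ι n * (ι n * (x * x))
        <⟨ +-monoʳ-< 1ℚ
            (subst (_< nx + nx + nx * nx) eq
            (+-monoˡ-< (nx * nx) (subst (_< nx + nx) (+-identityʳ 0ℚ) (+-mono-< 0<nx 0<nx)))) ⟩
      1ℚ + (nx + nx + nx * nx)
        ≡⟨ solve 1 (λ y → con 1ℚ :+ (y :+ y :+ y :* y) := (con 1ℚ :+ y) :* (con 1ℚ :+ y)) refl nx ⟩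
      (1ℚ + nx) * (1ℚ + nx) ≤⟨ *-mono-≤ 0≤1+nx (0≤^ n 0≤1+x) (bernoulli n 0≤x) (bernoulli n 0≤x) ⟩
      (1ℚ + x) ^ n * (1ℚ + x) ^ n ≡⟨ cong (λ M → M ^ n * M ^ n) 1+x≡M ⟩
      M ^ n * M ^ n ≡⟨ ^-+ M n n ⟨
      M ^ (n ℕ.+ n) ≤⟨ bound (n ℕ.+ n) ⟩
      ι (suc ((n ℕ.+ n) ℕ.* L)) ∎) (<-irrefl refl)
    where
    open ≤-Reasoning
    open +-*-Solver
    x = M - 1ℚ
    1+x≡M : 1ℚ + x ≡ M
    1+x≡M = solve 1 (λ M → con 1ℚ :+ (M :- con 1ℚ) := M) refl M
    0<x : 0ℚ < x
    0<x = +-monoˡ-< (- 1ℚ) (≰⇒> M≰1)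
    0≤x = <⇒≤ 0<x
    0≤1+x = +-mono-≤ 0≤1 0≤x
    0<xx : 0ℚ < x * x
    0<xx = subst (_< x * x) (*-zeroʳ x) (*-monoʳ-<-pos x {{positive 0<x}} 0<x)
    n,lt = archimedean (x * x) (ι (L ℕ.+ L)) 0<xx
    n = proj₁ n,lt
    2L<nxx = proj₂ n,lt
    nx = ι n * x
    0<nx : 0ℚ < nx
    0<nx = *-cancelʳ-<-nonNeg x {{nonNegative 0≤x}}
        (subst₂ _<_ (sym (*-zeroˡ x)) (sym (*-assoc (ι n) x x)) (≤-<-trans (0≤ι (L ℕ.+ L)) 2L<nxx))
    0≤1+nx = +-mono-≤ 0≤1 (<⇒≤ 0<nx)
    eq : 0ℚ + nx * nx ≡ ι n * (ι n * (x * x))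
    eq = solve 2 (λ n x → con 0ℚ :+ (n :* x) :* (n :* x) := n :* (n :* (x :* x))) refl (ι n) x
    ι-+ : ∀ m n → ι (m ℕ.+ n) ≡ ι m + ι n
    ι-+ zero n = sym (trans (cong (_+ ι n) ι-0) (+-identityˡ (ι n)))
    ι-+ (suc m) n =
        trans (ι-suc (m ℕ.+ n))
        (trans (cong (1ℚ +_) (ι-+ m n))
        (trans (sym (+-assoc 1ℚ (ι m) (ι n))) (cong (_+ ι n) (sym (ι-suc m)))))
    ι-* : ∀ m n → ι (m ℕ.* n) ≡ ι m * ι n
    ι-* zero n = trans ι-0 (sym (trans (cong (λ y → y * ι n) ι-0) (*-zeroˡ (ι n))))
    ι-* (suc m) n =
        trans (ι-+ n (m ℕ.* n))
        (trans (cong (ι n +_) (ι-* m n))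
        (trans (solve 2 (λ m n → n :+ m :* n := (con 1ℚ :+ m) :* n) refl (ι m) (ι n))
        (cong (λ y → y * ι n) (sym (ι-suc m)))))

-- Bernoulli measure of finite lists, Kraft's inequality and the lower bound for complete codes.

module BernoulliMeasure where
  open import Data.Integer.Base using () renaming (+_ to int)
  open import Data.Rational.Base
  open import Data.Rational.Properties hiding (_≟_)
  open import Data.Rational.Solver using (module +-*-Solver)
  open RationalPowers

  tuples : List B → ℕ → List (List B)
  tuples bs zero    = [] ∷ []
  tuples bs (suc n) = cartesianProductWith _∷_ bs (tuples bs n)

  tuples-All : ∀ {P : B → Set} {bs} n → All P bs → All (All P) (tuples bs n)
  tuples-All             zero    Pbs = [] ∷ []
  tuples-All {P = P} {bs} (suc n) Pbs = All.tabulate λ m →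
      case ∈-cartesianProductWith⁻ _∷_ bs (tuples bs n) m of λ where
    (_ , _ , b∈ , t∈ , refl) → All.lookup Pbs b∈ ∷ All.lookup (tuples-All n Pbs) t∈

  tuples-length : ∀ {bs : List B} n {t} → t ∈ˡ tuples bs n → length t ≡ n
  tuples-length zero (here refl) = refl
  tuples-length {bs = bs} (suc n) t∈ with _ , _ , _ , t∈ , refl ← ∈-cartesianProductWith⁻ _∷_ bs
      (tuples bs n) t∈
    = cong suc (tuples-length n t∈)

  tuples-unique : ∀ {bs : List B} n → Unique bs → Unique (tuples bs n)
  tuples-unique zero    u = [] ∷ []
  tuples-unique (suc n) u = Uniqueₚ.cartesianProductWith⁺ _∷_ ∷-injective u (tuples-unique n u)

  words-unique : ∀ {bs : List B} n → Unique bs → Unique (words bs n)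
  words-unique zero    u = [] ∷ []
  words-unique {bs = bs} (suc n) u =
      All.tabulate (λ m eq → case ∈-cartesianProductWith⁻ _∷_ bs (words bs n) m of λ where
      (_ , _ , _ , _ , refl) → case eq of λ ())
    ∷ Uniqueₚ.cartesianProductWith⁺ _∷_ ∷-injective u (words-unique n u)

  -- Injectivity is asked on `P` only: `concat` is injective on tuples of words of a code, not on
  -- all tuples.
  map-unique : ∀ {C : Set} {f : B → C} {P : B → Set} {bs} → (∀ {x y} → P x → P y → f x ≡ f y → x ≡ y) →
               All P bs → Unique bs → Unique (map f bs)
  map-unique inj []         []        = []
  map-unique inj (Pb ∷ Pbs) (b# ∷ u) =
    Allₚ.map⁺ (All.zipWith (λ (Pc , b≢c) eq → b≢c (inj Pb Pc eq)) (Pbs , b#)) ∷ map-unique inj Pbs u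

  module Measure {A : Set} (θ : ℚ) (0<θ : 0ℚ < θ) (θ≤1 : θ ≤ 1ℚ) where

    wt : List A → ℚ
    wt w = θ ^ length w

    -- Repetitions count. Upper bounds may be taken over lists with repetitions, since `μ-⊆` asks
    -- for distinct words only on the smaller side.
    μ : List (List A) → ℚ
    μ ws = foldr _+_ 0ℚ (map wt ws)

    wt-++ : ∀ u v → wt (u ++ v) ≡ wt u * wt v
    wt-++ u v = trans (cong (θ ^_) (length-++ u)) (^-+ θ (length u) (length v))

    0≤θ : 0ℚ ≤ θ
    0≤θ = <⇒≤ 0<θ

    0<^ : ∀ n → 0ℚ < θ ^ n
    0<^ zero    = positive⁻¹ 1ℚ
    0<^ (suc n) = positive⁻¹ (θ * θ ^ n) {{pos*pos⇒pos θ {{positive 0<θ}} (θ ^ n) {{positive (0<^ n)}}}}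

    ^-antitone : ∀ {m n} → m ℕ.≤ n → θ ^ n ≤ θ ^ m
    ^-antitone {n = zero}  z≤n = ≤-refl
    ^-antitone {n = suc n} z≤n =
        ≤-trans (*-mono-≤ 0≤θ 0≤1 θ≤1 (^-antitone {n = n} z≤n)) (≤-reflexive (*-identityˡ 1ℚ))
    ^-antitone (s≤s m≤n) = *-monoˡ-≤-nonNeg θ {{nonNegative 0≤θ}} (^-antitone m≤n)

    0<wt : ∀ w → 0ℚ < wt w
    0<wt w = 0<^ (length w)

    0≤wt : ∀ w → 0ℚ ≤ wt w
    0≤wt w = <⇒≤ (0<wt w)

    0≤μ : ∀ ws → 0ℚ ≤ μ ws
    0≤μ []       = ≤-refl
    0≤μ (w ∷ ws) = +-mono-≤ (0≤wt w) (0≤μ ws)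

    μ-++ : ∀ us vs → μ (us ++ vs) ≡ μ us + μ vs
    μ-++ []       vs = sym (+-identityˡ (μ vs))
    μ-++ (u ∷ us) vs = trans (cong (λ y → wt u + y) (μ-++ us vs)) (sym (+-assoc (wt u) (μ us) (μ vs)))

    μ-map : ∀ {C : Set} (f : C → List A) (g : C → List A) c → (∀ x → wt (f x) ≡ c * wt (g x)) →
            ∀ xs → μ (map f xs) ≡ c * μ (map g xs)
    μ-map f g c eq []       = sym (*-zeroʳ c)
    μ-map f g c eq (x ∷ xs) = trans (cong₂ _+_ (eq x) (μ-map f g c eq xs)) (sym (*-distribˡ-+ c _ _))

    -- The three maps let one identity serve for prepending a letter, for products of two words and
    -- for concatenating tuples.
    μ-product : ∀ {C : Set} (f : B → C → List A) (g : B → List A) (h : C → List A) →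
                (∀ b c → f b c ≡ g b ++ h c) → ∀ bs cs →
                μ (cartesianProductWith f bs cs) ≡ μ (map g bs) * μ (map h cs)
    μ-product f g h eq []       cs = sym (*-zeroˡ (μ (map h cs)))
    μ-product f g h eq (b ∷ bs) cs = begin
      μ (map (f b) cs ++ cartesianProductWith f bs cs) ≡⟨ μ-++ (map (f b) cs) _ ⟩
      μ (map (f b) cs) + μ (cartesianProductWith f bs cs)
        ≡⟨ cong₂ _+_ (μ-map (f b) h (wt (g b)) (λ c → trans (cong wt (eq b c)) (wt-++ (g b) (h c))) cs)
            (μ-product f g h eq bs cs) ⟩
      wt (g b) * μ (map h cs) + μ (map g bs) * μ (map h cs)
        ≡⟨ *-distribʳ-+ (μ (map h cs)) (wt (g b)) (μ (map g bs)) ⟨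
      μ (map g (b ∷ bs)) * μ (map h cs) ∎
      where open ≡-Reasoning

    μ-⊆ : ∀ {us} vs → Unique us → (∀ {w} → w ∈ˡ us → w ∈ˡ vs) → μ us ≤ μ vs
    μ-⊆ {[]}     vs _ _ = 0≤μ vs
    μ-⊆ {u ∷ us} vs uniq@(_ ∷ uniq′) sub with ∈-∃++ (sub (here refl))
    ... | ps , qs , refl = begin
      wt u + μ us ≤⟨ +-monoʳ-≤ (wt u) (μ-⊆ (ps ++ qs) uniq′ sub′) ⟩
      wt u + μ (ps ++ qs) ≡⟨ cong (λ y → wt u + y) (μ-++ ps qs) ⟩
      wt u + (μ ps + μ qs) ≡⟨ solve 3 (λ w p q → w :+ (p :+ q) := p :+ (w :+ q)) refl (wt u) (μ ps) (μ qs) ⟩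
      μ ps + μ (u ∷ qs) ≡⟨ μ-++ ps (u ∷ qs) ⟨
      μ (ps ++ u ∷ qs) ∎
      where
      open ≤-Reasoning
      open +-*-Solver
      sub′ : ∀ {w} → w ∈ˡ us → w ∈ˡ ps ++ qs
      sub′ w∈ with ∈-++⁻ ps (sub (there w∈))
      ... | inj₁ p = ∈-++⁺ˡ p
      ... | inj₂ (there p) = ∈-++⁺ʳ ps p
      ... | inj₂ (here refl) = contradiction w∈ (Uniqueₚ.Unique[x∷xs]⇒x∉xs uniq)

    -- A union bound. The factor `c` stays on the left because the bound on each piece is proved in
    -- this scaled form.
    μ-cover : ∀ {c D us} (bs : List B) (F : B → List (List A)) → 0ℚ ≤ c →
              Unique us → (∀ {w} → w ∈ˡ us → ∃[ b ] (b ∈ˡ bs × w ∈ˡ F b)) →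
              (∀ b → b ∈ˡ bs → c * μ (F b) ≤ D) → c * μ us ≤ ι (length bs) * D
    μ-cover {c = c} {D} {us} bs F 0≤c uniq cover bound = begin
      c * μ us ≤⟨ *-monoˡ-≤-nonNeg c {{nonNegative 0≤c}} (μ-⊆ (concatMap F bs) uniq λ w∈ →
                    let b , b∈ , w∈F = cover w∈ in ∈-concatMap⁺ F (lose b∈ w∈F)) ⟩
      c * μ (concatMap F bs) ≤⟨ total bs bound ⟩
      ι (length bs) * D ∎
      where
      open ≤-Reasoning
      total : ∀ bs → (∀ b → b ∈ˡ bs → c * μ (F b) ≤ D) → c * μ (concatMap F bs) ≤ ι (length bs) * D
      total []       bound =
          ≤-reflexive (trans (*-zeroʳ c) (sym (trans (cong (λ y → y * D) ι-0) (*-zeroˡ D))))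
      total (b ∷ bs) bound = begin
        c * μ (F b ++ concatMap F bs) ≡⟨ cong (λ y → c * y) (μ-++ (F b) _) ⟩
        c * (μ (F b) + μ (concatMap F bs)) ≡⟨ *-distribˡ-+ c _ _ ⟩
        c * μ (F b) + c * μ (concatMap F bs)
          ≤⟨ +-mono-≤ (bound b (here refl)) (total bs λ b b∈ → bound b (there b∈)) ⟩
        D + ι (length bs) * D ≡⟨ cong (λ y → y + ι (length bs) * D) (*-identityˡ D) ⟨
        1ℚ * D + ι (length bs) * D ≡⟨ *-distribʳ-+ D 1ℚ (ι (length bs)) ⟨
        (1ℚ + ι (length bs)) * D ≡⟨ cong (λ y → y * D) (ι-suc (length bs)) ⟨
        ι (suc (length bs)) * D ∎

    μ-tuples : ∀ ws n → μ (map concat (tuples ws n)) ≡ μ ws ^ n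
    μ-tuples ws zero    = +-identityʳ 1ℚ
    μ-tuples ws (suc n) = begin
      μ (map concat (cartesianProductWith _∷_ ws (tuples ws n))) ≡⟨ cong μ (map-product ws) ⟩
      μ (cartesianProductWith (λ w t → w ++ concat t) ws (tuples ws n))
        ≡⟨ μ-product (λ w t → w ++ concat t) id concat (λ _ _ → refl) ws (tuples ws n) ⟩
      μ (map id ws) * μ (map concat (tuples ws n)) ≡⟨ cong₂ _*_ (cong μ (map-id ws)) (μ-tuples ws n) ⟩
      μ ws * μ ws ^ n ∎
      where
      open ≡-Reasoning
      map-product : ∀ us →
          map concat (cartesianProductWith _∷_ us (tuples ws n)) ≡ cartesianProductWith
          (λ w t → w ++ concat t) us (tuples ws n)
      map-product []       = refl
      map-product (u ∷ us) = trans (map-++ concat (map (u ∷_) (tuples ws n)) _)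
        (cong₂ _++_ (sym (map-∘ (tuples ws n))) (map-product us))

    module Letters (as : List A) (all : ∀ a → a ∈ˡ as) (as-unique : Unique as)
        (θ-sum : ι (length as) * θ ≡ 1ℚ) where

      μ-letters : μ (map (λ a → a ∷ []) as) ≡ 1ℚ
      μ-letters = trans (sum as) θ-sum
        where
        open ≡-Reasoning
        sum : ∀ bs → μ (map (λ a → a ∷ []) bs) ≡ ι (length bs) * θ
        sum []       = sym (trans (cong (λ y → y * θ) ι-0) (*-zeroˡ θ))
        sum (b ∷ bs) = begin
          wt (b ∷ []) + μ (map (λ a → a ∷ []) bs) ≡⟨ cong₂ _+_ (*-comm θ 1ℚ) (sum bs) ⟩
          1ℚ * θ + ι (length bs) * θ ≡⟨ *-distribʳ-+ θ 1ℚ (ι (length bs)) ⟨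
          (1ℚ + ι (length bs)) * θ ≡⟨ cong (λ y → y * θ) (ι-suc (length bs)) ⟨
          ι (suc (length bs)) * θ ∎

      μ-words : ∀ n → μ (words as n) ≡ ι (suc n)
      μ-words zero    = trans (+-identityʳ 1ℚ) (sym ι-1)
      μ-words (suc n) = begin
        1ℚ + μ (cartesianProductWith _∷_ as (words as n))
          ≡⟨ cong (λ y → 1ℚ + y) (μ-product _∷_ (λ a → a ∷ []) id (λ _ _ → refl) as (words as n)) ⟩
        1ℚ + μ (map (λ a → a ∷ []) as) * μ (map id (words as n))
          ≡⟨ cong (λ y → 1ℚ + y) (cong₂ _*_ μ-letters (trans (cong μ (map-id (words as n))) (μ-words n))) ⟩
        1ℚ + 1ℚ * ι (suc n) ≡⟨ cong (λ y → 1ℚ + y) (*-identityˡ (ι (suc n))) ⟩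
        1ℚ + ι (suc n) ≡⟨ ι-suc (suc n) ⟨
        ι (suc (suc n)) ∎
        where open ≡-Reasoning

      -- McMillan's argument: `concat` is injective on the n-tuples of words of a code, so the n-th
      -- power of `μ ws` is at most the measure of all words of length at most n L, which is only n
      -- L + 1.
      kraft : {X : Language A} → Code X → ∀ ws → Unique ws → All X ws → μ ws ≤ 1ℚ
      kraft code ws uniq Xws = linear-powers⇒≤1 (μ ws) L λ n → begin
        μ ws ^ n ≡⟨ μ-tuples ws n ⟨
        μ (map concat (tuples ws n)) ≤⟨ μ-⊆ (words as (n ℕ.* L))
           (map-unique (λ {xs} {ys} Xxs Xys → code xs ys Xxs Xys) (tuples-All n Xws) (tuples-unique n uniq))
           (λ w∈ → case ∈-map⁻ concat w∈ of λ where
              (t , t∈ , refl) →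
                  words⁺ (concat t) all (subst (λ n → length (concat t) ℕ.≤ n ℕ.* L) (tuples-length n t∈)
                 (length-concat t (All.lookup (tuples-All n short) t∈)))) ⟩
        μ (words as (n ℕ.* L)) ≡⟨ μ-words (n ℕ.* L) ⟩
        ι (suc (n ℕ.* L)) ∎
        where
        open ≤-Reasoning
        total : List (List A) → ℕ
        total = foldr (λ w n → length w ℕ.+ n) 0
        -- Any bound on the lengths of the words in `ws` will do; their sum avoids taking a maximum.
        L = total ws
        ≤total : ∀ ws → All (λ w → length w ℕ.≤ total ws) ws
        ≤total []       = []
        ≤total (w ∷ ws) =
            ℕ.m≤m+n (length w) _ ∷ All.map (λ le → ℕ.≤-trans le (ℕ.m≤n+m _ (length w))) (≤total ws)
        short = ≤total ws
        length-concat : ∀ t → All (λ w → length w ℕ.≤ L) t → length (concat t) ℕ.≤ length t ℕ.* L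
        length-concat []      []       = z≤n
        length-concat (w ∷ t) (p ∷ ps) =
            ℕ.≤-trans (ℕ.≤-reflexive (length-++ w)) (ℕ.+-mono-≤ p (length-concat t ps))

      module Lower {X : Language A} (X? : Decidable X) (_≟_ : DecidableEquality A) where
        open Products as all X?

        -- With ratio at most 1 - ε the partial geometric sums stay below 1/ε. Multiplied by ε, the
        -- induction closes because ε + (1 - ε) · 1 = 1.
        μ-products : ∀ ε T m → 0ℚ ≤ ε → μ (upTo T) ≤ 1ℚ - ε → ε * μ (products T m) ≤ 1ℚ
        μ-products ε T zero 0≤ε S≤ = begin
          ε * (1ℚ + 0ℚ) ≡⟨ solve 1 (λ e → e :* (con 1ℚ :+ con 0ℚ) := con 1ℚ :- (con 1ℚ :- e)) refl ε ⟩
          -- That ε ≤ 1 follows from 0 ≤ `μ (upTo T)` ≤ 1 - ε.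
          1ℚ - (1ℚ - ε) ≤⟨ +-monoʳ-≤ 1ℚ (neg-antimono-≤ (≤-trans (0≤μ (upTo T)) S≤)) ⟩
          1ℚ ∎
          where
          open ≤-Reasoning
          open +-*-Solver
        μ-products ε T (suc m) 0≤ε S≤ = begin
          ε * (1ℚ + μ (cartesianProductWith _++_ (upTo T) P))
            ≡⟨ cong (λ y → ε * (1ℚ + y))
                (trans (μ-product _++_ id id (λ _ _ → refl) (upTo T) P)
                (cong₂ _*_ (cong μ (map-id (upTo T))) (cong μ (map-id P)))) ⟩
          ε * (1ℚ + μ (upTo T) * μ P)
            ≡⟨ solve 3 (λ e s p → e :* (con 1ℚ :+ s :* p) := e :+ s :* (e :* p)) refl ε (μ (upTo T)) (μ P) ⟩
          ε + μ (upTo T) * (ε * μ P)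
            ≤⟨ +-monoʳ-≤ ε (*-mono-≤ (0≤μ (upTo T)) 0≤1 S≤ (μ-products ε T m 0≤ε S≤)) ⟩
          ε + (1ℚ - ε) * 1ℚ ≡⟨ solve 1 (λ e → e :+ (con 1ℚ :- e) :* con 1ℚ := con 1ℚ) refl ε ⟩
          1ℚ ∎
          where
          open ≤-Reasoning
          open +-*-Solver
          P = products T m

        0<εc : ∀ C ε → 0ℚ < ε → 0ℚ < ε * (θ ^ C * θ ^ C)
        0<εc C ε 0<ε = positive⁻¹ _ {{pos*pos⇒pos ε {{positive 0<ε}} (θ ^ C * θ ^ C)
          {{pos*pos⇒pos (θ ^ C) {{positive (0<^ C)}} (θ ^ C) {{positive (0<^ C)}}}}}}

        -- Every word of length ≤ n lies in l⁻¹ X* r⁻¹ for some l, r of length ≤ C.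
        -- Hence n + 1, the measure of these words, is at most a constant multiple of
        -- the measure of X* up to length T = n + 2C, which is at most 1/ε if
        -- μ(X ∩ A^≤T) ≤ 1 - ε.
        context-bound : ∀ C →
          (∀ w → ∃₂ λ l r → (X *) (l ++ w ++ r) × length l ℕ.≤ C × length r ℕ.≤ C) →
          ∀ ε → 0ℚ < ε → ∀ n → μ (upTo (C ℕ.+ (n ℕ.+ C))) ≤ 1ℚ - ε →
          ε * (θ ^ C * θ ^ C) * ι (suc n) ≤ ι (length (cartesianProduct (words as C) (words as C)))
        context-bound C context ε 0<ε n S≤ = begin
            ε * c * ι (suc n) ≡⟨ cong (λ y → ε * c * y) (μ-words n) ⟨
            ε * c * μ (words as n)
              ≤⟨ μ-cover pairs V (<⇒≤ (0<εc C ε 0<ε)) (words-unique n as-unique) cover bound ⟩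
            ι (length pairs) * 1ℚ ≡⟨ *-identityʳ _ ⟩
            ι (length pairs) ∎
          where
          open ≤-Reasoning
          c = θ ^ C * θ ^ C
          pairs = cartesianProduct (words as C) (words as C)
          T = C ℕ.+ (n ℕ.+ C)

          in-products? : ∀ (lr : List A × List A) w →
              Dec (length (proj₁ lr ++ w ++ proj₂ lr) ℕ.≤ T × (X *) (proj₁ lr ++ w ++ proj₂ lr))
          in-products? (l , r) w = _ ℕ.≤? T ×-dec star? _≟_ (l ++ w ++ r)

          V : List A × List A → List (List A)
          V lr = filter (in-products? lr) (words as n)

          cover : ∀ {w} → w ∈ˡ words as n → ∃[ b ] (b ∈ˡ pairs × w ∈ˡ V b)
          cover {w} w∈ with l , r , p , l≤ , r≤ ← context w =
            (l , r) , ∈-cartesianProduct⁺ (words⁺ l all l≤) (words⁺ r all r≤) ,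
            ∈-filter⁺ (in-products? (l , r)) w∈
              (ℕ.≤-trans (ℕ.≤-reflexive (trans (length-++ l) (cong (length l ℕ.+_) (length-++ w))))
                  (ℕ.+-mono-≤ l≤ (ℕ.+-mono-≤ (words-length {bs = as} n w∈) r≤)) , p)

          bound : ∀ b → b ∈ˡ pairs → ε * c * μ (V b) ≤ 1ℚ
          bound b@(l , r) b∈ = begin
            ε * c * μ (V b) ≡⟨ *-assoc ε c _ ⟩
            ε * (c * μ (V b)) ≤⟨ *-monoˡ-≤-nonNeg ε {{nonNegative (<⇒≤ 0<ε)}} (begin
              -- As θ ≤ 1, the contexts `l` and `r`, of length at most `C`, weigh at least θ^C each:
              -- `c` pays for any pair of contexts. Passing from w to l w r is injective, so the
              -- images are distinct words of X*.
              c * μ (V b)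
                ≤⟨ *-mono-≤ 0≤c (0≤μ (V b)) (*-mono-≤ (<⇒≤ (0<^ C)) (0≤wt r) (c≤ l l≤) (c≤ r r≤)) ≤-refl ⟩
              wt l * wt r * μ (V b) ≡⟨ cong (λ vs → wt l * wt r * μ vs) (map-id (V b)) ⟨
              wt l * wt r * μ (map id (V b)) ≡⟨ μ-map (λ w → l ++ w ++ r) id (wt l * wt r) wt-lwr (V b) ⟨
              μ (map (λ w → l ++ w ++ r) (V b)) ≤⟨ μ-⊆ (products T T)
                 (map-unique {P = λ _ → ⊤} (λ _ _ eq → ++-cancelʳ r _ _ (++-cancelˡ l _ _ eq))
                     (All.universal (λ _ → tt) (V b))
                     (Uniqueₚ.filter⁺ (in-products? b) (words-unique n as-unique)))
                 sub ⟩
              μ (products T T) ∎) ⟩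
            ε * μ (products T T) ≤⟨ μ-products ε T T (<⇒≤ 0<ε) S≤ ⟩
            1ℚ ∎
            where
            l≤ = words-length C (proj₁ (∈-cartesianProduct⁻ (words as C) (words as C) b∈))
            r≤ = words-length C (proj₂ (∈-cartesianProduct⁻ (words as C) (words as C) b∈))
            0≤c : 0ℚ ≤ c
            0≤c = 0≤* (<⇒≤ (0<^ C)) (<⇒≤ (0<^ C))
            c≤ : ∀ w → length w ℕ.≤ C → θ ^ C ≤ wt w
            c≤ w le = ^-antitone le
            wt-lwr : ∀ w → wt (l ++ w ++ r) ≡ wt l * wt r * wt w
            wt-lwr w = trans (wt-++ l (w ++ r)) (trans (cong (λ y → wt l * y) (wt-++ w r))
              (solve 3 (λ l w r → l :* (w :* r) := l :* r :* w) refl (wt l) (wt w) (wt r)))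
              where open +-*-Solver
            sub : ∀ {z} → z ∈ˡ map (λ w → l ++ w ++ r) (V b) → z ∈ˡ products T T
            sub z∈ = let w , w∈ , z≡ = ∈-map⁻ (λ w → l ++ w ++ r) z∈
                         le , s = proj₂ (∈-filter⁻ (in-products? b) {xs = words as n} w∈)
                     in subst (_∈ˡ products T T) (sym z≡) (products-complete T T (l ++ w ++ r) le le s)

        -- Among the two sides of the bound in `context-bound` only the left one depends on `n`, and
        -- it grows without limit; a large `n` thus refutes a measure of at most 1 - ε.
        bounded-contexts⇒measure-1 : ∀ C →
          (∀ w → ∃₂ λ l r → (X *) (l ++ w ++ r) × length l ℕ.≤ C × length r ℕ.≤ C) →
          ∀ ε → 0ℚ < ε → ∃[ T ] 1ℚ - ε < μ (upTo T)
        bounded-contexts⇒measure-1 C context ε 0<ε =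
            let n , large = archimedean (ε * c) (ι k) (0<εc C ε 0<ε) in
            C ℕ.+ (n ℕ.+ C) , ≰⇒> λ S≤ →
                <-irrefl refl (<-≤-trans (large-strict n large) (context-bound C context ε 0<ε n S≤))
          where
          c = θ ^ C * θ ^ C
          k = length (cartesianProduct (words as C) (words as C))
          open ≤-Reasoning
          large-strict : ∀ n → ι k < ι n * (ε * c) → ι k < ε * c * ι (suc n)
          large-strict n large = begin-strict
            ι k <⟨ large ⟩
            ι n * (ε * c)
              ≤⟨ *-monoʳ-≤-nonNeg (ε * c) {{nonNegative (<⇒≤ (0<εc C ε 0<ε))}} (ι-mono (ℕ.n≤1+n n)) ⟩
            ι (suc n) * (ε * c) ≡⟨ *-comm (ι (suc n)) _ ⟩
            ε * c * ι (suc n) ∎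

  module Uniform {A : Set} (q : ℕ) .{{_ : NonTrivial q}}
      (as : List A) (all : ∀ a → a ∈ˡ as) (as-unique : Unique as) (|as|≡q : length as ≡ q) where
    private instance
      _ = nonTrivial⇒nonZero q

    θ : ℚ
    θ = int 1 / q

    ι-q*θ : ι q * θ ≡ 1ℚ
    ι-q*θ = ι-*-1/ q

    0<θ : 0ℚ < θ
    0<θ = positive⁻¹ θ {{normalize-pos 1 q}}

    θ≤1 : θ ≤ 1ℚ
    θ≤1 = begin
      θ       ≡⟨ *-identityˡ θ ⟨
      1ℚ * θ  ≡⟨ cong (λ y → y * θ) ι-1 ⟨
      ι 1 * θ ≤⟨ *-monoʳ-≤-nonNeg θ {{nonNegative (<⇒≤ 0<θ)}} (ι-mono {1} {q} (ℕ.>-nonZero⁻¹ q)) ⟩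
      ι q * θ ≡⟨ ι-q*θ ⟩
      1ℚ ∎
      where open ≤-Reasoning

    open Measure {A} θ 0<θ θ≤1
    open Letters as all as-unique (trans (cong (λ n → ι n * θ) |as|≡q) ι-q*θ)

    weight≡wt : ∀ w → weight q w ≡ wt w
    weight≡wt []      = refl
    weight≡wt (a ∷ w) =
        trans (sym (1/-* q (q ℕ.^ length w) {{nonTrivial⇒nonZero q}} {{q^≢0}}
        {{ℕ.m*n≢0 q _ {{nonTrivial⇒nonZero q}} {{q^≢0}}}}))
                              (cong (λ y → θ * y) (weight≡wt w))
      where
      q^≢0 : ℕ.NonZero (q ℕ.^ length w)
      q^≢0 = ℕ.m^n≢0 q (length w)

    finiteMeasure≡μ : ∀ ws → finiteMeasure q ws ≡ μ ws
    finiteMeasure≡μ ws = cong (foldr _+_ 0ℚ) (map-cong weight≡wt ws)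

    finiteMeasure≤1 : {X : Language A} → Code X → ∀ ws → Unique ws → All X ws → finiteMeasure q ws ≤ 1ℚ
    finiteMeasure≤1 code ws uniq Xws = subst (_≤ 1ℚ) (sym (finiteMeasure≡μ ws)) (kraft code ws uniq Xws)

    bounded-contexts⇒HasMeasure-1 : {X : Language A} → Decidable X → DecidableEquality A → Code X → ∀ C →
      (∀ w → ∃₂ λ l r → (X *) (l ++ w ++ r) × length l ℕ.≤ C × length r ℕ.≤ C) → HasMeasure q X 1ℚ
    bounded-contexts⇒HasMeasure-1 X? _≟_ code C context = finiteMeasure≤1 code , λ ε 0<ε →
      let T , lt = bounded-contexts⇒measure-1 C context ε 0<ε
      in upTo T , Uniqueₚ.filter⁺ X? (words-unique T as-unique) , Allₚ.all-filter X? (words as T) ,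
         subst (1ℚ - ε <_) (sym (finiteMeasure≡μ (upTo T))) lt
      where
      open Lower X? _≟_
      open Products as all X?

    HasMeasure-1⇒maximal : {X Y : Language A} → Decidable X → HasMeasure q X 1ℚ → Code Y → X ⊆ Y → Y ⊆ X
    HasMeasure-1⇒maximal {X} {Y} X? (_ , approx) Y-code X⊆Y {z} Yz with X? z
    ... | yes Xz = Xz
    -- The tolerance is the weight of `z`, so that adding `z` to the approximating list lifts its
    -- measure above 1.
    ... | no  ¬Xz with ws , uniq , Xws , lt ← approx (weight q z)
        (subst (0ℚ <_) (sym (weight≡wt z)) (0<wt z)) =
      contradiction (begin-strict
        1ℚ                              ≡⟨ solve 1 (λ w → con 1ℚ := w :+ (con 1ℚ :- w)) refl (weight q z) ⟩
        weight q z + (1ℚ - weight q z)  <⟨ +-monoʳ-< (weight q z) lt ⟩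
        finiteMeasure q (z ∷ ws)
          ≤⟨ finiteMeasure≤1 Y-code (z ∷ ws) (z∉ws Xws ∷ uniq) (Yz ∷ All.map X⊆Y Xws) ⟩
        1ℚ                              ∎) (<-irrefl refl)
      where
      open ≤-Reasoning
      open +-*-Solver
      z∉ws : ∀ {ws} → All X ws → All (z ≢_) ws
      z∉ws = All.map λ { Xv refl → ¬Xz Xv }

open BernoulliMeasure using (module Uniform)

-- Unbordered words and the completion of codes.

module Completions where
  open import Data.Nat.Base using (_+_; _*_; _∸_; _≤_; _<_)
  open import Data.Nat.Properties hiding (_≟_)
  open import Data.Nat.Solver using (module +-*-Solver)
  open import Data.List.Extrema ≤-totalOrder using (argmax; argmax-all; f[xs]≤f[argmax])

  Unbordered : List A → Set
  Unbordered y = ∀ r p s → y ≡ r ++ p → y ≡ p ++ s → p ≡ [] ⊎ r ≡ []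

  module Gaps {A : Set} (y : List A) (unbordered : Unbordered y) where

    Free : List A → Set
    Free g = ¬ (∃₂ λ l r → g ≡ l ++ y ++ r)

    -- In a word g y g₁ y g₂ ... every gap but `g` has a y in front of it; `join` covers these, and
    -- `g` is kept apart.
    join : List (List A) → List A
    join = concatMap (y ++_)

    -- If `g` is shorter than `g′`, the y after `g` either fits inside `g′`, which is free of y, or
    -- overlaps the y after `g′`, and the overlap `p` is a border.
    gap-unique-≤ : ∀ g {g′ h h′} → Free g′ → length g ≤ length g′ → g ++ y ++ h ≡ g′ ++ y ++ h′ →
        g ≡ g′ × h ≡ h′
    gap-unique-≤ g {g′} free′ le eq with levi g {us = g′} eq le
    ... | r , refl , eq′ with ≤-total (length y) (length r)
    ...   | inj₁ y≤r with r′ , refl , _ ← levi y {us = r} eq′ y≤r = contradiction (g , r′ , refl) free′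
    ...   | inj₂ r≤y with p , y≡rp , eq″ ← levi r {us = y} (sym eq′) r≤y
      with s , y≡ps , _ ← levi p {us = y} (sym eq″)
          (subst (length p ≤_) (sym (trans (cong length y≡rp) (length-++ r))) (m≤n+m _ (length r)))
      with unbordered r p s y≡rp y≡ps
    -- An empty overlap means r = y: then `g′` ends with a y.
    ...     | inj₁ refl =
        contradiction
        (g , [] , cong (g ++_) (trans (sym (++-identityʳ r)) (trans (sym y≡rp) (sym (++-identityʳ y))))) free′
    ...     | inj₂ refl = sym (++-identityʳ g) , ++-cancelˡ y _ _ eq′

    gap-unique : ∀ g g′ {h h′} → Free g → Free g′ → g ++ y ++ h ≡ g′ ++ y ++ h′ → g ≡ g′ × h ≡ h′
    gap-unique g g′ free free′ eq with ≤-total (length g) (length g′)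
    ... | inj₁ le = gap-unique-≤ g free′ le eq
    ... | inj₂ le = let p , r = gap-unique-≤ g′ free le (sym eq) in sym p , sym r

    join-injective : ∀ g g′ gs gs′ → Free g → Free g′ → All Free gs → All Free gs′ →
                     g ++ join gs ≡ g′ ++ join gs′ → g ≡ g′ × gs ≡ gs′
    join-injective g g′ [] [] _ _ _ _ eq = trans (sym (++-identityʳ g)) (trans eq (++-identityʳ g′)) , refl
    join-injective g g′ [] (h′ ∷ gs′) free _ _ _ eq =
      contradiction
          (g′ , h′ ++ join gs′ , trans (sym (++-identityʳ g))
          (trans eq (cong (g′ ++_) (++-assoc y h′ _)))) free
    join-injective g g′ (h ∷ gs) [] _ free′ _ _ eq =
      contradiction
          (g , h ++ join gs , trans (sym (++-identityʳ g′))
          (trans (sym eq) (cong (g ++_) (++-assoc y h _)))) free′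
    join-injective g g′ (h ∷ gs) (h′ ∷ gs′) free free′ (fh ∷ fs) (fh′ ∷ fs′) eq =
      let p , r = gap-unique g g′ free free′ (trans (cong (g ++_) (sym (++-assoc y h _))) (trans eq (cong (g′ ++_) (++-assoc y h′ _))))
          p′ , r′ = join-injective h h′ gs gs′ fh fh′ fs fs′ r
      in p , cong₂ _∷_ p′ r′

  -- The Ehrenfeucht–Rozenberg completion X ∪ y(Uy)*, where U consists of the words
  -- outside X* that do not contain y.
  module Completion {A : Set} (X : Language A) (code : Code X) (star? : Decidable (X *))
      (_≟_ : DecidableEquality A)
                    (y : List A) (unbordered : Unbordered y) (y∉ : ¬ InFactor (X *) y) where
    open Gaps y unbordered
    open Star {X = X}

    U : Language A
    U u = ¬ (X *) u × Free u

    chain : List (List A) → List A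
    chain []       = y
    chain (u ∷ us) = y ++ u ++ chain us

    Z : Language A
    Z w = ∃[ us ] (All U us × w ≡ chain us)

    Y : Language A
    Y w = X w ⊎ Z w

    y∈Y : Y y
    y∈Y = inj₂ ([] , [] , refl)

    -- The gaps between consecutive occurrences of y: a word of U, or a product of
    -- words of X.
    Gap : Set
    Gap = List A ⊎ List (List A)

    word : Gap → List A
    word (inj₁ u)  = u
    word (inj₂ bs) = concat bs

    Valid : Gap → Set
    Valid (inj₁ u)  = U u
    Valid (inj₂ bs) = All X bs

    star-free : ∀ {w} → (X *) w → Free w
    star-free s (l , r , refl) = y∉ (l , r , s)

    valid-free : ∀ gs → All Valid gs → All Free (map word gs)
    valid-free [] [] = []
    valid-free (inj₁ u ∷ gs) (Uu ∷ vs) = proj₂ Uu ∷ valid-free gs vs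
    valid-free (inj₂ bs ∷ gs) (Xbs ∷ vs) = star-free (bs , Xbs , refl) ∷ valid-free gs vs

    word-injective : ∀ gs gs′ → All Valid gs → All Valid gs′ → map word gs ≡ map word gs′ → gs ≡ gs′
    word-injective [] [] _ _ _ = refl
    word-injective (g ∷ gs) (g′ ∷ gs′) (v ∷ vs) (v′ ∷ vs′) eq =
      let p , r = ∷-injective eq in cong₂ _∷_ (single g g′ v v′ p) (word-injective gs gs′ vs vs′ r)
      where
      single : ∀ g g′ → Valid g → Valid g′ → word g ≡ word g′ → g ≡ g′
      single (inj₁ u)  (inj₁ u′)  _ _ refl = refl
      single (inj₁ u)  (inj₂ bs′) (u∉ , _) v′ eq = contradiction (bs′ , v′ , sym eq) u∉
      single (inj₂ bs) (inj₁ u′)  v (u∉ , _) eq = contradiction (bs , v , eq) u∉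
      single (inj₂ bs) (inj₂ bs′) v v′ eq = cong inj₂ (code bs bs′ v v′ eq)

    prepend : List A → List (List A) → List (List A)
    -- A default value: in a parse every run of `inj₁` gaps is followed by an `inj₂` gap, so a
    -- factor to prolong exists.
    prepend u []       = []
    prepend u (z ∷ zs) = (y ++ u ++ z) ∷ zs

    -- Rebuilds a factorization over Y from the gaps alone: a U-gap merges with the chain that
    -- follows it, an X*-gap ends a chain with its y. Equal gaps therefore give equal
    -- factorizations.
    factors : List Gap → List (List A)
    factors []            = []
    factors (inj₁ u ∷ gs)  = prepend u (factors gs)
    factors (inj₂ bs ∷ gs) = y ∷ bs ++ factors gs

    factors-chain : ∀ us bs gs → factors (map inj₁ us ++ inj₂ bs ∷ gs) ≡ chain us ∷ bs ++ factors gs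
    factors-chain []       bs gs = refl
    factors-chain (u ∷ us) bs gs = cong (prepend u) (factors-chain us bs gs)

    join-chain : ∀ us bs gs →
        join (map word (map inj₁ us ++ inj₂ bs ∷ gs)) ≡ chain us ++ concat bs ++ join (map word gs)
    join-chain []       bs gs = ++-assoc y (concat bs) _
    join-chain (u ∷ us) bs gs = begin
      (y ++ u) ++ join (map word (map inj₁ us ++ inj₂ bs ∷ gs)) ≡⟨ cong ((y ++ u) ++_) (join-chain us bs gs) ⟩
      (y ++ u) ++ chain us ++ rest ≡⟨ ++-assoc y u _ ⟩
      y ++ u ++ chain us ++ rest ≡⟨ cong (y ++_) (++-assoc u (chain us) rest) ⟨
      y ++ (u ++ chain us) ++ rest ≡⟨ ++-assoc y _ rest ⟨
      (y ++ u ++ chain us) ++ rest ∎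
      where
      open ≡-Reasoning
      rest = concat bs ++ join (map word gs)

    -- Each word of Z contributes its U-gaps and then one `inj₂` gap with the words of X that follow
    -- it, possibly none. The empty word is in X*, hence not in U, so even an empty gap between two
    -- chains is of one kind only.
    parse : ∀ xs → All Y xs → ∃₂ λ bs gs → All X bs × All Valid gs ×
            concat xs ≡ concat bs ++ join (map word gs) × xs ≡ bs ++ factors gs
    parse [] [] = [] , [] , [] , [] , refl , refl
    parse (x ∷ xs) (inj₁ Xx ∷ Yxs) with bs , gs , Xbs , vs , p , r ← parse xs Yxs =
      x ∷ bs , gs , Xx ∷ Xbs , vs , trans (cong (x ++_) p) (sym (++-assoc x (concat bs) _)) , cong (x ∷_) r
    parse (_ ∷ xs) (inj₂ (us , Uus , refl) ∷ Yxs) with bs , gs , Xbs , vs , p , r ← parse xs Yxs =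
      [] , map inj₁ us ++ inj₂ bs ∷ gs , [] , Allₚ.++⁺ (Allₚ.map⁺ Uus) (Xbs ∷ vs) ,
      trans (cong (chain us ++_) p) (sym (join-chain us bs gs)) ,
      trans (cong (chain us ∷_) r) (sym (factors-chain us bs gs))

    Y-code : Code Y
    Y-code xs xs′ Yxs Yxs′ eq
      with bs , gs , Xbs , vs , p , r ← parse xs Yxs | bs′ , gs′ , Xbs′ , vs′ , p′ , r′ ← parse xs′ Yxs′
      with e , e′ ← join-injective (concat bs) (concat bs′) (map word gs) (map word gs′)
             (star-free (bs , Xbs , refl)) (star-free (bs′ , Xbs′ , refl)) (valid-free gs vs)
                 (valid-free gs′ vs′)
             (trans (sym p) (trans eq p′))
      = trans r (trans
          (cong₂ (λ bs gs → bs ++ factors gs) (code bs bs′ Xbs Xbs′ e) (word-injective gs gs′ vs vs′ e′))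
          (sym r′))

    1≤|y| : 1 ≤ length y
    1≤|y| = n≢0⇒n>0 λ |y|≡0 → y∉ ([] , [] , subst (X *) (sym (trans (++-identityʳ y) (empty y |y|≡0))) []∈*)
      where
      empty : ∀ (w : List A) → length w ≡ 0 → w ≡ []
      empty [] _ = refl

    |lyr| : ∀ l r → length (l ++ y ++ r) ≡ length l + (length y + length r)
    |lyr| l r = trans (length-++ l) (cong (length l +_) (length-++ y))

    |y|≤ : ∀ l r → length y ≤ length (l ++ y ++ r)
    |y|≤ l r = ≤-trans (≤-trans (m≤m+n _ (length r)) (m≤n+m _ (length l))) (≤-reflexive (sym (|lyr| l r)))

    |l|< : ∀ l r → length l < length (l ++ y ++ r)
    |l|< l r = <-≤-trans (m<m+n (length l) (≤-trans 1≤|y| (m≤m+n _ (length r))))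
        (≤-reflexive (sym (|lyr| l r)))

    |r|< : ∀ l r → length r < length (l ++ y ++ r)
    |r|< l r = <-≤-trans (≤-trans (+-monoˡ-≤ (length r) 1≤|y|) (m≤n+m _ (length l)))
        (≤-reflexive (sym (|lyr| l r)))

    -- With the leading y in place, an occurrence of y in `z` splits y z into y l and y r, which are
    -- treated separately; `n` bounds the length and makes the recursion structural.
    gaps : ∀ n z → length z ≤ n → ∃[ gs ] (All Valid gs × join (map word gs) ≡ y ++ z)
    gaps n z le with Infixₚ.infix? _≟_ y z
    ... | no ¬f with star? z
    ...   | yes (bs , Xbs , refl) = inj₂ bs ∷ [] , Xbs ∷ [] , ++-identityʳ _
    ...   | no  z∉ = inj₁ z ∷ [] , (z∉ , λ { (l , r , refl) → ¬f (factor⁺ l) }) ∷ [] , ++-identityʳ _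
    gaps n z le | yes f with factor⁻ f
    gaps zero    _ le | yes f | l , r , refl =
      contradiction (≤-trans (≤-trans 1≤|y| (|y|≤ l r)) le) λ ()
    gaps (suc n) _ le | yes f | l , r , refl
      with gs , vs , p ← gaps n l (≤-pred (≤-trans (|l|< l r) le))
         | gs′ , vs′ , p′ ← gaps n r (≤-pred (≤-trans (|r|< l r) le))
      = gs ++ gs′ , Allₚ.++⁺ vs vs′ , (begin
        join (map word (gs ++ gs′)) ≡⟨ cong join (map-++ word gs gs′) ⟩
        join (map word gs ++ map word gs′) ≡⟨ concatMap-++ (y ++_) (map word gs) (map word gs′) ⟩
        join (map word gs) ++ join (map word gs′) ≡⟨ cong₂ _++_ p p′ ⟩
        (y ++ l) ++ y ++ r ≡⟨ ++-assoc y l _ ⟩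
        y ++ l ++ y ++ r ∎)
      where open ≡-Reasoning

    -- The y added at the end closes the last chain. The first chain `us` is kept apart because a
    -- U-gap put in front prolongs it, whereas an X*-gap sets it down as a factor and starts a new
    -- chain.
    conjugate∈* : ∀ gs → All Valid gs → ∃₂ λ us zs →
        All U us × All Y zs × chain us ++ concat zs ≡ join (map word gs) ++ y
    conjugate∈* [] [] = [] , [] , [] , [] , ++-identityʳ y
    conjugate∈* (inj₁ u ∷ gs) (Uu ∷ vs) with us , zs , Uus , Yzs , eq ← conjugate∈* gs vs =
      u ∷ us , zs , Uu ∷ Uus , Yzs , (begin
        (y ++ u ++ chain us) ++ concat zs ≡⟨ ++-assoc y _ _ ⟩
        y ++ (u ++ chain us) ++ concat zs ≡⟨ cong (y ++_) (++-assoc u _ _) ⟩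
        y ++ u ++ chain us ++ concat zs ≡⟨ cong (λ v → y ++ u ++ v) eq ⟩
        y ++ u ++ join (map word gs) ++ y ≡⟨ ++-assoc y u _ ⟨
        (y ++ u) ++ join (map word gs) ++ y ≡⟨ ++-assoc (y ++ u) _ y ⟨
        ((y ++ u) ++ join (map word gs)) ++ y ∎)
      where open ≡-Reasoning
    conjugate∈* (inj₂ bs ∷ gs) (Xbs ∷ vs) with us , zs , Uus , Yzs , eq ← conjugate∈* gs vs =
      [] , bs ++ chain us ∷ zs , [] , Allₚ.++⁺ (All.map inj₁ Xbs) (inj₂ (us , Uus , refl) ∷ Yzs) , (begin
        y ++ concat (bs ++ chain us ∷ zs) ≡⟨ cong (y ++_) (concat-++ bs _) ⟨
        y ++ concat bs ++ chain us ++ concat zs ≡⟨ cong (λ v → y ++ concat bs ++ v) eq ⟩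
        y ++ concat bs ++ join (map word gs) ++ y ≡⟨ ++-assoc y (concat bs) _ ⟨
        (y ++ concat bs) ++ join (map word gs) ++ y ≡⟨ ++-assoc (y ++ concat bs) _ y ⟨
        ((y ++ concat bs) ++ join (map word gs)) ++ y ∎)
      where open ≡-Reasoning

    yzy∈Y* : ∀ z → ∃[ zs ] (All Y zs × concat zs ≡ y ++ z ++ y)
    yzy∈Y* z with gs , vs , p ← gaps (length z) z ≤-refl
             with us , zs , Uus , Yzs , eq ← conjugate∈* gs vs
      = chain us ∷ zs , inj₂ (us , Uus , refl) ∷ Yzs , trans eq (trans (cong (_++ y) p) (++-assoc y z y))

    -- The word y w y has a factorization over Y and the factorization y, w, y over W. Both are over
    -- the code W, so they coincide, and w is one of the factors in Y.
    Y-maximal : ∀ W → Code W → Y ⊆ W → W ⊆ Y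
    Y-maximal W W-code Y⊆W {w} Ww with zs , Yzs , eq ← yzy∈Y* w
      with refl ← W-code zs (y ∷ w ∷ y ∷ []) (All.map Y⊆W Yzs) (Y⊆W y∈Y ∷ Ww ∷ Y⊆W y∈Y ∷ [])
                   (trans eq (cong (λ v → y ++ w ++ v) (sym (++-identityʳ y))))
      with _ ∷ Yw ∷ _ ← Yzs = Yw

  -- Words sharing a long factor, and the decision of independence.

  ≤-from-tails : ∀ (u f : List A) {t v} → f ++ t ≡ u ++ v → length t ≤ length v → length u ≤ length f
  ≤-from-tails u f {t} {v} eq t≤v = +-cancelʳ-≤ (length t) _ _ (begin
    length u + length t ≤⟨ +-monoʳ-≤ (length u) t≤v ⟩
    length u + length v ≡⟨ length-++ u ⟨
    length (u ++ v)     ≡⟨ cong length eq ⟨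
    length (f ++ t)     ≡⟨ length-++ f ⟩
    length f + length t ∎)
    where open ≤-Reasoning

  -- `𝓕 k` with any common factor instead of a longest one. The two agree, since a longest one
  -- leaves the fewest letters outside, and this form allows a search over the outer words.
  record Near {A : Set} (k : ℕ) (w w′ : List A) : Set where
    constructor near
    field
      f s t s′ t′ : List A
      w≡    : w ≡ s ++ f ++ t
      w′≡   : w′ ≡ s′ ++ f ++ t′
      outer : (length s + length t) + (length s′ + length t′) ≤ k

  length-split : ∀ (s f t : List A) → length (s ++ f ++ t) ≡ length s + (length f + length t)
  length-split s f t = trans (length-++ s) (cong (length s +_) (length-++ f))

  length-outer : ∀ (f s t s′ t′ : List A) → (length (s ++ f ++ t) + length (s′ ++ f ++ t′)) ∸ 2 * length f ≡
                 (length s + length t) + (length s′ + length t′)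
  length-outer f s t s′ t′ = begin
    (length (s ++ f ++ t) + length (s′ ++ f ++ t′)) ∸ 2 * length f
      ≡⟨ cong (_∸ 2 * length f) (trans (cong₂ _+_ (length-split s f t) (length-split s′ f t′))
           (solve 5 (λ s t s′ t′ f →
               s :+ (f :+ t) :+ (s′ :+ (f :+ t′)) := s :+ t :+ (s′ :+ t′) :+ con 2 :* f) refl
             (length s) (length t) (length s′) (length t′) (length f))) ⟩
    (length s + length t) + (length s′ + length t′) + 2 * length f ∸ 2 * length f
      ≡⟨ m+n∸n≡m _ (2 * length f) ⟩
    (length s + length t) + (length s′ + length t′) ∎
    where
    open ≡-Reasoning
    open +-*-Solver

  𝓕⇒near : ∀ {k} {w w′ : List A} → 𝓕 k w w′ → Near k w w′
  𝓕⇒near {k = k} (f , (fw , fw′ , _) , le) with s , t , refl ← factor⁻ fw | s′ , t′ , refl ← factor⁻ fw′ =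
    near f s t s′ t′ refl refl (subst (_≤ k) (length-outer f s t s′ t′) le)

  module _ (_≟_ : DecidableEquality A) (as : List A) (all : ∀ a → a ∈ˡ as) where

    maxCommonFactor : ∀ w w′ → ∃[ f ] IsMaxCommonFactor f w w′
    maxCommonFactor w w′ = m , proj₁ common , proj₂ common , λ g gw gw′ →
        All.lookup (f[xs]≤f[argmax] {f = length} [] cs)
            (∈-filter⁺ common? (words⁺ g all (Infixₚ.length-mono gw)) (gw , gw′))
      where
      Common : List A → Set
      Common g = Factor g w × Factor g w′
      common? : Decidable Common
      common? g = Infixₚ.infix? _≟_ g w ×-dec Infixₚ.infix? _≟_ g w′
      cs = filter common? (words as (length w))
      m = argmax length [] cs
      common : Common m
      common = argmax-all length {P = Common} (factor⁺ [] , factor⁺ [])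
          (Allₚ.all-filter common? (words as (length w)))

    near⇒𝓕 : ∀ {k} {w w′ : List A} → Near k w w′ → 𝓕 k w w′
    near⇒𝓕 {k} {w} {w′} (near f s t s′ t′ refl refl le) with m , m-max@(_ , _ , max) ← maxCommonFactor w w′ =
      m , m-max , ≤-trans (∸-monoʳ-≤ (length w + length w′) (*-monoʳ-≤ 2 (max f (factor⁺ s) (factor⁺ s′))))
        (subst (_≤ k) (sym (length-outer f s t s′ t′)) le)

    Separated : ℕ → Language A → Set
    Separated k X = ∀ {x x′} → X x → X x′ → Near k x x′ → x ≡ x′

    separated⇒independent : ∀ {k X} → Separated k X → Independent (𝓕≢ k) X
    separated⇒independent sep y ((x , Xx , F , x≢y) , Xy) = x≢y (sep Xx Xy (𝓕⇒near F))

    independent⇒separated : ∀ {k X} → Independent (𝓕≢ k) X → Separated k X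
    independent⇒separated ind {x} {x′} Xx Xx′ nr with ≡-dec _≟_ x x′
    ... | yes eq = eq
    ... | no x≢x′ = contradiction ((x , Xx , near⇒𝓕 nr , x≢x′) , Xx′) (ind x′)

    -- At most `k` letters lie outside the common factor, so the four outer words range over a
    -- finite set; for each choice the middles `f` of a conflict form a language of finite index.
    separated? : ∀ k {X} → Decidable X → FiniteIndex X → Dec (Separated k X)
    separated? k {X} X? fi with any? conflict? contexts
      where
      Conflict : (List A × List A) × (List A × List A) → Set
      Conflict ((s , t) , (s′ , t′)) = (length s + length t) + (length s′ + length t′) ≤ k ×
        ∃[ f ] (X (s ++ f ++ t) × X (s′ ++ f ++ t′) × s ++ f ++ t ≢ s′ ++ f ++ t′)
      conflict? : Decidable Conflict
      conflict? ((s , t) , (s′ , t′)) = _ ≤? k ×-dec ∃-word? as all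
        (fi-∩ (fi-append t (fi-prepend s fi))
            (fi-∩ (fi-append t′ (fi-prepend s′ fi)) (fi-∁ (fi-equation as all _≟_ s t s′ t′))))
        (λ f → X? _ ×-dec X? _ ×-dec ¬? (≡-dec _≟_ _ _))
      contexts = cartesianProduct (cartesianProduct (words as k) (words as k))
          (cartesianProduct (words as k) (words as k))
    ... | yes p with ((s , t) , (s′ , t′)) , le , f , Xw , Xw′ , w≢w′ ← satisfied p =
      no λ sep → w≢w′ (sep Xw Xw′ (near f s t s′ t′ refl refl le))
    ... | no ¬p = yes sep
      where
      sep : Separated k X
      sep {x} {x′} Xx Xx′ (near f s t s′ t′ refl refl le) with ≡-dec _≟_ x x′
      ... | yes eq = eq
      ... | no x≢x′ =
          contradiction (lose (∈-cartesianProduct⁺ (∈-cartesianProduct⁺ s∈ t∈) (∈-cartesianProduct⁺ s′∈ t′∈))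
                        (le , f , Xx , Xx′ , x≢x′)) ¬p
        where
        st≤k   = m+n≤o⇒m≤o (length s + length t) le
        s′t′≤k = m+n≤o⇒n≤o (length s + length t) le
        s∈  = words⁺ s all (m+n≤o⇒m≤o (length s) st≤k)
        t∈  = words⁺ t all (m+n≤o⇒n≤o (length s) st≤k)
        s′∈ = words⁺ s′ all (m+n≤o⇒m≤o (length s′) s′t′≤k)
        t′∈ = words⁺ t′ all (m+n≤o⇒n≤o (length s′) s′t′≤k)

  -- Aligning two words along a common factor.

  replicate-++⁻ : ∀ {a : A} n s {e} → replicate n a ≡ s ++ e →
      ∃[ j ] (s ≡ replicate (length s) a × e ≡ replicate j a × n ≡ length s + j)
  replicate-++⁻ n       []      eq = n , refl , sym eq , refl
  replicate-++⁻ (suc n) (x ∷ s) eq with refl , eq′ ← ∷-injective eq with j , p , r ,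
      q ← replicate-++⁻ n s eq′ =
    j , cong (x ∷_) p , r , cong suc q

  replicate-∷-injective : ∀ {a b : A} → a ≢ b → ∀ i j {u v} →
      replicate i a ++ b ∷ u ≡ replicate j a ++ b ∷ v → i ≡ j
  replicate-∷-injective a≢b zero    zero    eq = refl
  replicate-∷-injective a≢b zero    (suc j) eq = contradiction (sym (proj₁ (∷-injective eq))) a≢b
  replicate-∷-injective a≢b (suc i) zero    eq = contradiction (proj₁ (∷-injective eq)) a≢b
  replicate-∷-injective a≢b (suc i) (suc j) eq =
      cong suc (replicate-∷-injective a≢b i j (proj₂ (∷-injective eq)))

  -- The first b, at position m in both words, can be seen from f.
  synchronize : ∀ {a b : A} → a ≢ b → ∀ m f s t s′ t′ {u u′} →
    s ++ f ++ t ≡ replicate m a ++ b ∷ u → s′ ++ f ++ t′ ≡ replicate m a ++ b ∷ u′ →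
    length s ≤ m → length s′ ≤ m → m < length f → s ≡ s′
  synchronize {a = a} {b} a≢b m f s t s′ t′ {u} {u′} eq eq′ s≤m s′≤m m<f
    with e , p , r ← levi s {us = replicate m a} eq (≤-trans s≤m (≤-reflexive (sym (length-replicate m))))
       | e′ , p′ , r′ ← levi s′ {us = replicate m a} eq′
           (≤-trans s′≤m (≤-reflexive (sym (length-replicate m))))
    with i , s≡ , refl , m≡ ← replicate-++⁻ m s p | j , s′≡ , refl , m≡′ ← replicate-++⁻ m s′ p′
    with levi (replicate j a) {us = f} (sym r′)
        (≤-trans (≤-reflexive (length-replicate j))
        (<⇒≤ (≤-<-trans (subst (j ≤_) (sym m≡′) (m≤n+m j _)) m<f)))
  ... | [] , q , _ =
      contradiction
      (≤-trans m<f
      (≤-trans (≤-reflexive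
      (trans (cong length q)
      (trans (length-++ (replicate j a)) (trans (+-identityʳ _) (length-replicate j)))))
      (subst (j ≤_) (sym m≡′) (m≤n+m j _)))) (<-irrefl refl)
  ... | c ∷ g , q , q′ with refl ← proj₁ (∷-injective q′)
    with refl ← replicate-∷-injective a≢b i j
        (trans (sym r) (trans (cong (_++ t) q) (++-assoc (replicate j a) (b ∷ g) t)))
    = trans s≡ (trans (cong (λ l → replicate l a) (+-cancelʳ-≡ i _ _ (trans (sym m≡) m≡′))) (sym s′≡))

  reverse-replicate : ∀ n (a : A) → reverse (replicate n a) ≡ replicate n a
  reverse-replicate zero    a = refl
  reverse-replicate (suc n) a =
      trans (unfold-reverse a (replicate n a)) (trans (cong (_++ a ∷ []) (reverse-replicate n a)) (snoc n))
    where
    snoc : ∀ n → replicate n a ++ a ∷ [] ≡ replicate (suc n) a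
    snoc zero    = refl
    snoc (suc n) = cong (a ∷_) (snoc n)

  synchronize-suffix : ∀ {a b : A} → a ≢ b → ∀ m f s t s′ t′ {u u′} →
    s ++ f ++ t ≡ u ++ b ∷ replicate m a → s′ ++ f ++ t′ ≡ u′ ++ b ∷ replicate m a →
    length t ≤ m → length t′ ≤ m → m < length f → t ≡ t′
  synchronize-suffix {a = a} {b} a≢b m f s t s′ t′ eq eq′ t≤m t′≤m m<f = reverse-injective
    (synchronize a≢b m (reverse f) (reverse t) (reverse s) (reverse t′) (reverse s′)
      (mirror s t eq) (mirror s′ t′ eq′)
      (≤-trans (≤-reflexive (length-reverse t)) t≤m) (≤-trans (≤-reflexive (length-reverse t′)) t′≤m)
      (≤-trans m<f (≤-reflexive (sym (length-reverse f)))))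
    where
    reverse₃ : ∀ u v w → reverse (u ++ v ++ w) ≡ reverse w ++ reverse v ++ reverse u
    reverse₃ u v w =
        trans (reverse-++ u (v ++ w))
        (trans (cong (_++ reverse u) (reverse-++ v w)) (++-assoc (reverse w) (reverse v) (reverse u)))
    mirror : ∀ s t {u} → s ++ f ++ t ≡ u ++ b ∷ replicate m a →
        reverse t ++ reverse f ++ reverse s ≡ replicate m a ++ b ∷ reverse u
    mirror s t {u} eq = trans (sym (reverse₃ s f t)) (trans (cong reverse eq)
      (trans (reverse₃ u (b ∷ []) (replicate m a)) (cong (_++ b ∷ reverse u) (reverse-replicate m a))))

  replicate-head : ∀ {a c : A} {k u v} → 1 ≤ k → replicate k a ++ v ≡ c ∷ u → c ≡ a
  replicate-head (s≤s _) eq = sym (proj₁ (∷-injective eq))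

  -- The unbordered word y.

  module Separator {A : Set} (_≟_ : DecidableEquality A) {a b : A} (a≢b : a ≢ b) (k : ℕ) (1≤k : 1 ≤ k)
      (w : List A) where

    h : List A
    h = replicate k a ++ b ∷ w ++ a ∷ []

    -- With this exponent `h` ends at the midpoint of y: past n letters only b occurs, a border and
    -- its complement cannot both be shorter than n, and y without k letters is still longer than n.
    n : ℕ
    n = length h

    y : List A
    y = replicate k a ++ b ∷ w ++ a ∷ replicate n b

    y≡h++ : y ≡ h ++ replicate n b
    y≡h++ = sym (trans (++-assoc (replicate k a) _ _) (cong (λ v → replicate k a ++ b ∷ v) (++-assoc w _ _)))

    k<n : k < n
    k<n = ≤-trans (m<m+n k (s≤s z≤n))
        (≤-reflexive
        (sym (trans (length-++ (replicate k a)) (cong (_+ length (b ∷ w ++ a ∷ [])) (length-replicate k)))))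

    |y| : length y ≡ n + n
    |y| = trans (cong length y≡h++) (trans (length-++ h) (cong (n +_) (length-replicate n)))

    y-head : ∀ {c r p} → y ≡ (c ∷ r) ++ p → c ≡ a
    y-head = replicate-head 1≤k

    all-b : ∀ {z p} → replicate n b ≡ z ++ p → All (b ≡_) p
    all-b {z} eq = Allₚ.++⁻ʳ z (subst (All (b ≡_)) eq (Allₚ.replicate⁺ n refl))

    count : List A → ℕ
    count v = length (filter (a ≟_) v)

    count-++ : ∀ u v → count (u ++ v) ≡ count u + count v
    count-++ u v = trans (cong length (filter-++ (a ≟_) u v)) (length-++ (filter (a ≟_) u))

    remainder-short : ∀ r p → y ≡ r ++ a ∷ p → ¬ n ≤ length r
    remainder-short r p eq le with z , _ , eq′ ← levi h {us = r} (trans (sym y≡h++) eq) le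
      with b≡a ∷ _ ← all-b {z} eq′ = a≢b (sym b≡a)

    -- A border p starts with a, so it is longer than bⁿ; in y = r p = p s the
    -- remainder s then lies in bⁿ, while r starts with a and has as many a's as s.
    unbordered : Unbordered y
    unbordered r       []      s rp ps = inj₁ refl
    unbordered []      (c ∷ p) s rp ps = inj₂ refl
    unbordered (d ∷ r)
        (c ∷ p) s rp ps with refl ← y-head {p = s} ps | refl ← y-head {p = c ∷ p} rp with ≤-total n
        (length (d ∷ r)) | ≤-total n (length (c ∷ p))
    ... | inj₁ n≤r | _ = contradiction n≤r (remainder-short (d ∷ r) p rp)
    ... | inj₂ r≤n | inj₂ p≤n = contradiction n≤r (remainder-short (d ∷ r) p rp)
      where
      n≤r : n ≤ length (d ∷ r)
      n≤r = +-cancelʳ-≤ n _ _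
          (≤-trans (≤-reflexive (trans (sym |y|) (trans (cong length rp) (length-++ (d ∷ r)))))
          (+-monoʳ-≤ (length (d ∷ r)) p≤n))
    ... | inj₂ _ | inj₁ le′ with z , _ , eq ← levi h {us = c ∷ p} (trans (sym y≡h++) ps) le′ =
        contradiction count-eq λ ()
      where
      count-s : count s ≡ 0
      count-s = cong length
          (filter-none (a ≟_) (All.map (λ b≡c a≡c → a≢b (trans a≡c (sym b≡c))) (all-b {z} eq)))
      count-r : count (d ∷ r) ≡ suc (count r)
      count-r = cong length (filter-accept (a ≟_) {d} {r} refl)
      count-eq : suc (count r) ≡ 0
      count-eq = trans (sym count-r) (trans (+-cancelʳ-≡ (count (c ∷ p)) _ _ (begin
        count (d ∷ r) + count (c ∷ p) ≡⟨ count-++ (d ∷ r) (c ∷ p) ⟨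
        count ((d ∷ r) ++ c ∷ p) ≡⟨ cong count (trans (sym rp) ps) ⟩
        count ((c ∷ p) ++ s) ≡⟨ count-++ (c ∷ p) s ⟩
        count (c ∷ p) + count s ≡⟨ +-comm (count (c ∷ p)) _ ⟩
        count s + count (c ∷ p) ∎)) count-s)
        where open ≡-Reasoning

  -- Independence of the completed code.

  module SeparatedCompletion {A : Set} (_≟_ : DecidableEquality A) (as : List A) (all : ∀ a → a ∈ˡ as)
      {a b : A} (a≢b : a ≢ b) (k : ℕ) (1≤k : 1 ≤ k)
      (X : Language A) (code : Code X) (star? : Decidable (X *)) (w : List A) (w∉ : ¬ InFactor (X *) w) where

    open Separator _≟_ a≢b k 1≤k w public

    y∉ : ¬ InFactor (X *) y
    y∉ (l , r , s) = w∉ (l ++ replicate k a ++ b ∷ [] , (a ∷ replicate n b) ++ r , subst (X *) (begin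
      l ++ y ++ r ≡⟨ cong (l ++_) (++-assoc (replicate k a) _ r) ⟩
      l ++ replicate k a ++ b ∷ (w ++ a ∷ replicate n b) ++ r
        ≡⟨ cong (λ v → l ++ replicate k a ++ b ∷ v) (++-assoc w _ r) ⟩
      l ++ replicate k a ++ (b ∷ []) ++ w ++ (a ∷ replicate n b) ++ r
        ≡⟨ cong (l ++_) (++-assoc (replicate k a) (b ∷ []) _) ⟨
      l ++ (replicate k a ++ b ∷ []) ++ w ++ (a ∷ replicate n b) ++ r ≡⟨ ++-assoc l _ _ ⟨
      (l ++ replicate k a ++ b ∷ []) ++ w ++ (a ∷ replicate n b) ++ r ∎) s)
      where open ≡-Reasoning

    open Completion X code star? _≟_ y unbordered y∉ public
    open Star {X = X}

    Z-prefix : ∀ {z} → Z z → ∃[ v ] z ≡ y ++ v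
    Z-prefix ([]     , _ , refl) = [] , sym (++-identityʳ y)
    Z-prefix (u ∷ us , _ , refl) = u ++ chain us , refl

    Z-suffix : ∀ {z} → Z z → ∃[ v ] z ≡ v ++ y
    Z-suffix (us , _ , refl) = go us
      where
      go : ∀ us → ∃[ v ] chain us ≡ v ++ y
      go []       = [] , refl
      go (u ∷ us) with v , eq ← go us =
          y ++ u ++ v , trans (cong (λ c → y ++ u ++ c) eq)
          (sym (trans (++-assoc y _ y) (cong (y ++_) (++-assoc u v y))))

    -- The length that both alignments ask for: it exceeds n, the exponent at the right end, and so
    -- k at the left end.
    Z-long : ∀ f s t → Z (s ++ f ++ t) → length s + length t ≤ k → n < length f
    Z-long f s t Zz le with v , eq ← Z-prefix Zz = +-cancelˡ-< k n (length f) (begin-strict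
      k + n <⟨ +-monoˡ-< n k<n ⟩
      n + n ≡⟨ |y| ⟨
      length y ≤⟨ m≤m+n _ (length v) ⟩
      length y + length v ≡⟨ length-++ y ⟨
      length (y ++ v) ≡⟨ cong length eq ⟨
      length (s ++ f ++ t) ≡⟨ length-split s f t ⟩
      length s + (length f + length t)
        ≡⟨ solve 3 (λ s f t → s :+ (f :+ t) := s :+ t :+ f) refl (length s) (length f) (length t) ⟩
      length s + length t + length f ≤⟨ +-monoˡ-≤ (length f) le ⟩
      k + length f ∎)
      where
      open ≤-Reasoning
      open +-*-Solver

    k≤tail : ∀ v → k ≤ length (a ∷ replicate n b ++ v)
    k≤tail v = begin
        k ≤⟨ <⇒≤ k<n ⟩
        n ≡⟨ length-replicate n ⟨
        length (replicate n b) ≤⟨ m≤m+n _ (length v) ⟩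
        length (replicate n b) + length v ≡⟨ length-++ (replicate n b) ⟨
        length (replicate n b ++ v) ≤⟨ n≤1+n _ ⟩
        length (a ∷ replicate n b ++ v) ∎
      where open ≤-Reasoning

    -- The loss on the left stays within the block aᵏ of the leading y, and the loss on the right
    -- within what follows its w, which has at least k letters.
    Z-sees-w : ∀ f s t → Z (s ++ f ++ t) → length s + length t ≤ k → ∃₂ λ l r → f ≡ l ++ w ++ r
    Z-sees-w f s t Zz le with v , eq ← Z-prefix Zz
      with e , _ , r ← levi s {us = replicate k a}
             (trans eq (trans (++-assoc (replicate k a) _ v)
                 (cong (λ u → replicate k a ++ b ∷ u) (++-assoc w _ v))))
             (≤-trans (m+n≤o⇒m≤o (length s) le) (≤-reflexive (sym (length-replicate k))))
      with ebw≡ ← trans (++-assoc e (b ∷ w) (a ∷ replicate n b ++ v)) (sym r)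
      with g , q , _ ← levi (e ++ b ∷ w) {us = f} ebw≡
          (≤-from-tails (e ++ b ∷ w) f (sym ebw≡) (≤-trans (m+n≤o⇒n≤o (length s) le) (k≤tail v)))
      = e ++ b ∷ [] , g , trans q (trans (++-assoc e _ g) (sym (++-assoc e _ (w ++ g))))

    X-Z-far : ∀ f s t s′ t′ → X (s ++ f ++ t) → Z (s′ ++ f ++ t′) → ¬ length s′ + length t′ ≤ k
    X-Z-far f s t s′ t′ Xx Zz le with l , r , refl ← Z-sees-w f s′ t′ Zz le =
      w∉ (s ++ l , r ++ t , subst (X *)
          (trans (cong (s ++_) (trans (++-assoc l _ t) (cong (l ++_) (++-assoc w r t))))
          (sym (++-assoc s l _))) (x∈* Xx))

    Z-separated : ∀ f s t s′ t′ → Z (s ++ f ++ t) → Z (s′ ++ f ++ t′) → length s + length t ≤ k →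
        length s′ + length t′ ≤ k →
                  s ++ f ++ t ≡ s′ ++ f ++ t′
    Z-separated f s t s′ t′ Zz Zz′ le le′
      with v , eq ← Z-prefix Zz | v′ , eq′ ← Z-prefix Zz′ | u , eq₂ ← Z-suffix Zz | u′ , eq₂′ ← Z-suffix Zz′
      = cong₂ (λ s t → s ++ f ++ t)
          (synchronize a≢b k f s t s′ t′ (prefix eq) (prefix eq′) (m+n≤o⇒m≤o (length s) le)
              (m+n≤o⇒m≤o (length s′) le′) (<-trans k<n n<f))
          -- Read from the right, y begins with n letters b and then an a: the letters exchange
          -- roles and n replaces k.
          (synchronize-suffix (a≢b ∘ sym) n f s t s′ t′ (suffix u eq₂) (suffix u′ eq₂′)
            (≤-trans (m+n≤o⇒n≤o (length s) le) (<⇒≤ k<n)) (≤-trans (m+n≤o⇒n≤o (length s′) le′) (<⇒≤ k<n)) n<f)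
      where
      n<f = Z-long f s t Zz le
      prefix : ∀ {z v} → z ≡ y ++ v → z ≡ replicate k a ++ b ∷ (w ++ a ∷ replicate n b) ++ v
      prefix {v = v} eq = trans eq (++-assoc (replicate k a) _ v)
      suffix : ∀ {z} u → z ≡ u ++ y → z ≡ (u ++ replicate k a ++ b ∷ w) ++ a ∷ replicate n b
      suffix u eq = trans eq (sym (trans (++-assoc u _ _) (cong (u ++_) (++-assoc (replicate k a) _ _))))

    Y-separated : Separated _≟_ as all k X → Separated _≟_ as all k Y
    Y-separated sep (inj₁ Xx) (inj₁ Xx′) nr = sep Xx Xx′ nr
    Y-separated sep (inj₁ Xx) (inj₂ Zz′) (near f s t s′ t′ refl refl le) =
      contradiction (m+n≤o⇒n≤o (length s + length t) le) (X-Z-far f s t s′ t′ Xx Zz′)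
    Y-separated sep (inj₂ Zz) (inj₁ Xx′) (near f s t s′ t′ refl refl le) =
      contradiction (m+n≤o⇒m≤o (length s + length t) le) (X-Z-far f s′ t′ s t Xx′ Zz)
    Y-separated sep (inj₂ Zz) (inj₂ Zz′) (near f s t s′ t′ refl refl le) =
      Z-separated f s t s′ t′ Zz Zz′ (m+n≤o⇒m≤o (length s + length t) le) (m+n≤o⇒n≤o (length s + length t) le)

open Completions

open import Data.Nat.Base using (_≤_; _<_)
open import Data.Rational.Base using (1ℚ)

-- Finite alphabets.

module Alphabet {A : Set} {q : ℕ} (A↔Fin : A ↔ Fin q) where
  open Inverse A↔Fin

  from-injective : ∀ {i j} → from i ≡ from j → i ≡ j
  from-injective {i} {j} eq = trans (sym (strictlyInverseˡ i)) (trans (cong to eq) (strictlyInverseˡ j))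

  letters : List A
  letters = map from (allFin q)

  ∈-letters : ∀ a → a ∈ˡ letters
  ∈-letters a = subst (_∈ˡ letters) (strictlyInverseʳ a) (∈-map⁺ from (∈-allFin (to a)))

  letters-unique : Unique letters
  letters-unique = Uniqueₚ.map⁺ from-injective (Uniqueₚ.allFin⁺ q)

  length-letters : length letters ≡ q
  length-letters = trans (length-map from (allFin q)) (length-tabulate {n = q} id)

  _≟_ : DecidableEquality A
  a ≟ b = map′ (λ eq → trans (sym (strictlyInverseʳ a)) (trans (cong from eq) (strictlyInverseʳ b)))
      (cong to) (to a Fin.≟ to b)

  distinct-letters : 1 < q → ∃[ a ] ∃[ b ] a ≢ b
  distinct-letters 1<q = from (fromℕ< 0<q) , from (fromℕ< 1<q) , λ eq →
    contradiction
        (trans (sym (Fin.toℕ-fromℕ< 0<q)) (trans (cong toℕ (from-injective eq)) (Fin.toℕ-fromℕ< 1<q))) λ ()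
    where
    0<q : 0 < q
    0<q = ℕ.<-trans (s≤s z≤n) 1<q

-- Completeness, measure and maximality of a regular code.

module RegularCode {A : Set} (q : ℕ) .{{_ : NonTrivial q}} (A↔Fin : A ↔ Fin q) (k : ℕ) (1≤k : 1 ≤ k)
    (X : Language A) (X-regular : Regular X) (X-code : Code X) where
  open Alphabet A↔Fin
  open Uniform q letters ∈-letters letters-unique length-letters

  X? : Decidable X
  X? w = map′ (proj₂ (proj₂ X-regular)) (proj₁ (proj₂ X-regular)) (Paths.recognized? (proj₁ X-regular) w)

  star? : Decidable (X *)
  star? = Products.star? letters ∈-letters X? _≟_

  open RegularStar (proj₁ X-regular) (proj₂ X-regular) star?

  Contexts : Set
  Contexts = ∀ w → InFactor (X *) w

  complete⇒contexts : Complete X → Contexts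
  complete⇒contexts complete w with z , Xz , wz ← complete w with l , r , refl ← factor⁻ wz = l , r , Xz

  contexts⇒complete : Contexts → Complete X
  contexts⇒complete contexts w with l , r , p ← contexts w = l ++ w ++ r , p , factor⁺ l

  abstract
    -- The words that are no factor of X* form a language of finite index, so a search among short
    -- words either finds one or proves that there is none.
    complete-or-missing : Complete X ⊎ (∃[ w ] ¬ InFactor (X *) w)
    complete-or-missing =
        decide (∃-word? letters ∈-letters (fi-∁ (fi-factor letters ∈-letters fi-star)) (λ w → ¬? (factor? w)))
      where
      factor? : Decidable (InFactor (X *))
      factor? = inFactor? letters ∈-letters fi-star star?
      decide : Dec (∃[ w ] ¬ InFactor (X *) w) → Complete X ⊎ (∃[ w ] ¬ InFactor (X *) w)
      decide (yes missing) = inj₂ missing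
      decide (no none)     = inj₁ (contexts⇒complete λ w → decidable-stable (factor? w) λ w∉ → none (w , w∉))

  complete⇒measure : Complete X → HasMeasure q X 1ℚ
  complete⇒measure complete = bounded-contexts⇒HasMeasure-1 X? _≟_ X-code (FiniteIndex.index# fi-star)
    λ w → factor-short fi-star w (complete⇒contexts complete w)

  -- Measure 1 makes `X` maximal among all codes, hence among the independent ones.
  complete⇒maximal : Complete X → Independent (𝓕≢ k) X → MaximalIn (IndependentCode (𝓕≢ k)) X
  complete⇒maximal complete ind = (X-code , ind) , λ W (W-code , _) X⊆W →
    HasMeasure-1⇒maximal X? (complete⇒measure complete) W-code X⊆W , X⊆W

  module Incomplete (w : List A) (w∉ : ¬ InFactor (X *) w) where
    private
      ab = distinct-letters (nonTrivial⇒n>1 q)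
    open SeparatedCompletion _≟_ letters ∈-letters (proj₂ (proj₂ ab)) k 1≤k X X-code star? w w∉ public

    X⊆Y : X ⊆ Y
    X⊆Y = inj₁

    y∉X : ¬ X y
    y∉X Xy = y∉ ([] , [] , subst (X *) (sym (++-identityʳ y)) (Star.x∈* Xy))

    Y-maximalIn : Independent (𝓕≢ k) X → MaximalIn (IndependentCode (𝓕≢ k)) Y
    Y-maximalIn ind =
        (Y-code , separated⇒independent _≟_ letters ∈-letters
        (Y-separated (independent⇒separated _≟_ letters ∈-letters ind))) ,
      λ W (W-code , _) Y⊆W → Y-maximal W W-code Y⊆W , Y⊆W

    not-maximal : ¬ MaximalIn (IndependentCode (𝓕≢ k)) X
    not-maximal ((_ , ind) , maximal) = y∉X (proj₁ (maximal Y (proj₁ (Y-maximalIn ind)) X⊆Y) y∈Y)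

    not-measure-1 : ¬ HasMeasure q X 1ℚ
    not-measure-1 measure = y∉X (HasMeasure-1⇒maximal X? measure Y-code X⊆Y y∈Y)

  measure⇒complete : HasMeasure q X 1ℚ → Complete X
  measure⇒complete measure with complete-or-missing
  ... | inj₁ complete = complete
  ... | inj₂ (w , w∉) = contradiction measure (Incomplete.not-measure-1 w w∉)

  maximal⇒complete : MaximalIn (IndependentCode (𝓕≢ k)) X → Complete X
  maximal⇒complete maximal with complete-or-missing
  ... | inj₁ complete = complete
  ... | inj₂ (w , w∉) = contradiction maximal (Incomplete.not-maximal w w∉)

  independent? : Dec (Independent (𝓕≢ k) X)
  independent? =
      map′ (separated⇒independent _≟_ letters ∈-letters) (independent⇒separated _≟_ letters ∈-letters)
    (separated? _≟_ letters ∈-letters k X? fi-regular)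

  maximal? : Dec (MaximalIn (IndependentCode (𝓕≢ k)) X)
  maximal? with independent? | complete-or-missing
  ... | no ¬ind | _             = no λ ((_ , ind) , _) → ¬ind ind
  ... | yes ind | inj₁ complete = yes (complete⇒maximal complete ind)
  ... | yes _   | inj₂ (w , w∉) = no (Incomplete.not-maximal w w∉)

  embed : Independent (𝓕≢ k) X → ∃[ Y ] (X ⊆ Y × MaximalIn (IndependentCode (𝓕≢ k)) Y)
  embed ind with complete-or-missing
  ... | inj₁ complete = X , id , complete⇒maximal complete ind
  ... | inj₂ (w , w∉) = Y , X⊆Y , Y-maximalIn ind
    where open Incomplete w w∉

proposition5p4 : (A : Set) (q : ℕ) .{{_ : NonTrivial q}} → A ↔ Fin q →
    (k : ℕ) → 1 ≤ k →
    (X : Language A) → Regular X → Code X →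
    ( (Independent (𝓕≢ k) X →
    MaximalIn (IndependentCode (𝓕≢ k)) X ⇔ Complete X)
    × (Complete X ⇔ HasMeasure q X 1ℚ) )
    × Dec (MaximalIn (IndependentCode (𝓕≢ k)) X)
    × (Independent (𝓕≢ k) X →
    ∃[ Y ] (X ⊆ Y × MaximalIn (IndependentCode (𝓕≢ k)) Y))
proposition5p4 A q A↔Fin k 1≤k X X-regular X-code =
  ( (λ ind → mk⇔ maximal⇒complete (λ complete → complete⇒maximal complete ind))
  , mk⇔ complete⇒measure measure⇒complete )
  , maximal? , embed
  where open RegularCode q A↔Fin k 1≤k X X-regular X-code
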